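{- Let $G$ be a $2$-connected planar graph with a fixed embedding on the sphere, and let $H$ be a greedy filling of some face $C$ of $G$ inside some subgraph $G'$ of $G$, such that $H$ is a $k$-filling of $C$. Then any simple cycle in $G$ of length $\ell$ interacts with at most $(k+1)\cdot\ell$ faces of $H$. Moreover, if the cycle is contained in $H$, then it interacts with at most $\ell$ faces of $H$.
   Context: Graphs are finite and simple; planar graphs come with a fixed embedding on the sphere $\mathbb S^2$, and a face of a $2$-connected plane graph is identified with its boundary cycle. A path or cycle $P$ is a $D$-local geodesic in a graph $F$ if $\mathrm{dist}_P(u,v)=\mathrm{dist}_F(u,v)$ for all $u,v\in V(P)$ with $\mathrm{dist}_P(u,v)\le D$. A $k$-filling of a cycle $C$ of $G$ is a $2$-connected planar subgraph $H$ of $G$, having $C$ as a face, all of whose faces except $C$ have size (boundary length) at most $k$. Greedy filling of a face cycle $C$ inside a $2$-connected plane graph $G'$ of which $C$ is a face (with threshold $D=10\delta$, $\delta\ge 1$ a parameter): start with $H=C$, $C_1=C$, $G_1=G'$. In iteration $i$: if the cycle $C_i$ is a $D$-local geodesic in $G_i$, add $C_i$ to $H$ and stop. Otherwise choose a minimal (minimum-length) subpath $P_i$ of $C_i$ that is not a shortest path in $G_i$, let $u,v$ be its endpoints, let $Q_i$ be a shortest $u$–$v$ path in $G_i$ (it is disjoint from $P_i$ except for $u,v$), add $Q_i$ to $H$, set $C_{i+1}=(C_i-P_i)\cup Q_i$ (remove from $C_i$ the edges and interior vertices of $P_i$, and add $Q_i$), let $G_{i+1}$ be the subgraph of $G_i$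 bounded by $C_{i+1}$ (on the side not containing the internal vertices of $P_i$), and continue with $i+1$. The final graph $H$ is a greedy filling of $C$ inside $G'$; its faces other than $C$ are the cycles $P_i\cup Q_i$ and the last cycle $C_i$. A filling face of $H$ is a face of $H$ other than $C$, and the faces of $H$ counted in the claim are filling faces. A cycle $\gamma$ in $G$ interacts with a filling face $F$ (viewed as a region of $\mathbb S^2$) if $F$ does not lie between $C$ and $\gamma$; that is, either $\gamma$ intersects the interior of the region $F$, or $\gamma$ separates the interior of $F$ from (the face) $C$. -}

module Defs where

open import Data.Bool.Base using (Bool; true; false; not; _∧_)
open import Data.Empty using (⊥)
open import Data.Fin.Base using (Fin)
open import Data.Fin.Properties using (_≟_)
open import Data.Fin.Subset as Subset using (Subset; _∈_; _⊆_; _∪_; ⋃; ⁅_⁆; _-_; ∣_∣)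
open import Data.Integer.Base as ℤ using (+_)
open import Data.List.Base using (List; []; _∷_; _++_; map; length; drop)
open import Data.List.Membership.Propositional renaming (_∈_ to _∈ᴸ_) using ()
open import Data.List.Relation.Unary.Unique.Propositional using (Unique)
open import Data.Nat.Base using (ℕ; _+_; _*_; _≤_)
open import Data.Nat.GeneralisedArithmetic using (iterate)
open import Data.Product.Base using (_×_; _,_; proj₁; proj₂; ∃; ∃₂; ∃-syntax)
open import Data.Rational.Base as ℚ using (ℚ)
open import Data.Sum.Base using (_⊎_)
open import Data.Vec.Base using (lookup; tabulate)
open import Function.Bundles using (_⇔_; _↔_; module Inverse)
open import Function.Definitions using (Injective)
open import Relation.Binary.Construct.Closure.Equivalence using (EqClosure)
open import Relation.Binary.PropositionalEquality.Core using (_≡_; _≢_)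
open import Relation.Nullary.Decidable.Core using (does)
open import Relation.Nullary.Negation.Core using (¬_)

-- A finite simple graph.  A dart is an edge with a direction; the two darts
-- of the edge e are (e , true) and (e , false).
record Graph : Set where
  field
    nV nE : ℕ

  Vertex : Set
  Vertex = Fin nV

  Edge : Set
  Edge = Fin nE

  Dart : Set
  Dart = Edge × Bool

  rev : Dart → Dart
  rev d = proj₁ d , not (proj₂ d)

  field
    src : Dart → Vertex

  tgt : Dart → Vertex
  tgt d = src (rev d)

  field
    loopless : ∀ d → src d ≢ tgt d
    simple   : ∀ {d d′} → src d ≡ src d′ → tgt d ≡ tgt d′ → d ≡ d′

module GraphNotions (G : Graph) where
  open Graph G public

  -- A set of vertices and edges; it is a subgraph when it satisfies IsSubgraph.
  record Part : Set where
    constructor ⟨_,_⟩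
    field
      verts : Subset nV
      edges : Subset nE
  open Part public

  IsSubgraph : Part → Set
  IsSubgraph K = ∀ e b → e ∈ edges K → src (e , b) ∈ verts K

  whole : Part
  whole = ⟨ Subset.⊤ , Subset.⊤ ⟩

  infixr 6 _∪ᵖ_
  _∪ᵖ_ : Part → Part → Part
  K ∪ᵖ L = ⟨ verts K ∪ verts L , edges K ∪ edges L ⟩

  infix 4 _⊆ᵖ_
  _⊆ᵖ_ : Part → Part → Set
  K ⊆ᵖ L = (verts K ⊆ verts L) × (edges K ⊆ edges L)

  infixl 5 _-ᵖ_
  _-ᵖ_ : Part → Vertex → Part
  K -ᵖ w = ⟨ verts K - w , tabulate survives ⟩
    where
    survives : Edge → Bool
    survives e = lookup (edges K) e ∧ not (does (src (e , true) ≟ w))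
                                    ∧ not (does (src (e , false) ≟ w))

  -- Walk K u ds v: the darts ds form a walk from u to v inside K.
  data Walk (K : Part) : Vertex → List Dart → Vertex → Set where
    nil  : ∀ {u} → u ∈ verts K → Walk K u [] u
    cons : ∀ {u v e b ds} → src (e , b) ≡ u → u ∈ verts K → e ∈ edges K →
           Walk K (tgt (e , b)) ds v → Walk K u ((e , b) ∷ ds) v

  Path : Part → Vertex → List Dart → Vertex → Set
  Path K u ds v = Walk K u ds v × Unique (u ∷ map tgt ds)

  -- Length at least 3 excludes running back and forth along one edge.
  Cycle : Part → List Dart → Set
  Cycle K ds = (∃ λ u → Walk K u ds u) × Unique (map src ds) × 3 ≤ length ds

  -- The subgraph formed by a nonempty walk.
  trace : List Dart → Part
  trace ds = ⟨ ⋃ (map (λ d → ⁅ src d ⁆ ∪ ⁅ tgt d ⁆) ds) , ⋃ (map (λ (e , _) → ⁅ e ⁆) ds) ⟩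

  Connected : Part → Set
  Connected K = ∀ {u v} → u ∈ verts K → v ∈ verts K → ∃[ ds ] Walk K u ds v

  TwoConnected : Part → Set
  TwoConnected K = IsSubgraph K × 3 ≤ ∣ verts K ∣ × Connected K × (∀ w → Connected (K -ᵖ w))

  -- Dist K u v n: the distance of u and v in K exists and equals n.
  Dist : Part → Vertex → Vertex → ℕ → Set
  Dist K u v n = (∃[ ds ] Walk K u ds v × length ds ≡ n)
               × (∀ ds → Walk K u ds v → n ≤ length ds)

  ShortestPath : Part → Vertex → List Dart → Vertex → Set
  ShortestPath K u ds v = Path K u ds v × Dist K u v (length ds)

  -- The threshold is rational; only its integer part matters, so this is as
  -- general as a real threshold.
  LocalGeodesic : ℚ → Part → Part → Set
  LocalGeodesic D P F = ∀ u v n → u ∈ verts P → v ∈ verts P →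
    Dist P u v n → (+ n ℚ./ 1) ℚ.≤ D → Dist F u v n

  -- Up to the choice of its first dart, the closed walk C is P followed by R,
  -- where P runs from u to v and R is not empty.  For a cycle C these P are
  -- exactly the subpaths of C, traversed in the direction of C, and R is C − P.
  Subpath : List Dart → Vertex → List Dart → Vertex → List Dart → Set
  Subpath C u P v R = (∃₂ λ A B → C ≡ A ++ B × B ++ A ≡ P ++ R)
                    × Walk (trace C) u P v × R ≢ []

  interior : List Dart → List Vertex
  interior P = map src (drop 1 P)

-- An embedding of a connected graph with at least one edge on the sphere: a
-- rotation system of Euler characteristic 2.  The darts leaving a vertex are
-- cyclically permuted by rot, and the faces are the orbits of rot ∘ rev,
-- labelled by Fin nF.
record SphereEmbedding (G : Graph) : Set where
  open GraphNotions G
  field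
    connected : Connected whole
    rot       : Dart ↔ Dart

  turn : Dart → Dart
  turn = Inverse.to rot

  next : Dart → Dart
  next d = turn (rev d)

  field
    turn-src    : ∀ d → src (turn d) ≡ src d
    turn-cyclic : ∀ {d d′} → src d ≡ src d′ → ∃[ n ] iterate turn d n ≡ d′

    nF          : ℕ
    faceOf      : Dart → Fin nF
    face-onto   : ∀ f → ∃[ d ] faceOf d ≡ f
    face-next   : ∀ d → faceOf (next d) ≡ faceOf d
    face-orbit  : ∀ {d d′} → faceOf d ≡ faceOf d′ → ∃[ n ] iterate next d n ≡ d′

    euler       : nV + nF ≡ nE + 2

module PlaneNotions (G : Graph) (S : SphereEmbedding G) where
  open GraphNotions G public
  open SphereEmbedding S public

  -- The sphere is the disjoint union of the open cells of the embedding.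
  data Cell : Set where
    vert : Vertex → Cell
    edge : Edge → Cell
    face : Fin nF → Cell

  -- a ≺ b: the cell a lies in the closure of the cell b.
  data _≺_ : Cell → Cell → Set where
    vert-edge : ∀ e b → vert (src (e , b)) ≺ edge e
    edge-face : ∀ e b → edge e ≺ face (faceOf (e , b))
    vert-face : ∀ d → vert (src d) ≺ face (faceOf d)

  infix 4 _∈ᶜ_
  _∈ᶜ_ : Cell → Part → Set
  vert v ∈ᶜ K = v ∈ verts K
  edge e ∈ᶜ K = e ∈ edges K
  face f ∈ᶜ K = ⊥

  -- For cells outside the subgraph K: lying in the same connected component of
  -- 𝕊² ∖ K.  (A cell of K is related to itself only.)
  Joined : Part → Cell → Cell → Set
  Joined K = EqClosure (λ a b → a ≺ b × ¬ (a ∈ᶜ K) × ¬ (b ∈ᶜ K))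

  -- The faces of a subgraph K are the components of 𝕊² ∖ K.  Each contains a
  -- face of G, so a face of K is represented by any face of G contained in it,
  -- and SameFace K is equality of faces of K.
  SameFace : Part → Fin nF → Fin nF → Set
  SameFace K f g = Joined K (face f) (face g)

  OnBoundary : Part → Fin nF → Edge → Set
  OnBoundary K f e = e ∈ edges K × (∃[ b ] SameFace K (faceOf (e , b)) f)

  -- C is the boundary cycle of the face f of K.
  IsFaceCycle : Part → List Dart → Fin nF → Set
  IsFaceCycle K C f = Cycle K C × (∀ e → e ∈ edges (trace C) ⇔ OnBoundary K f e)

  -- K′ is the subgraph of K bounded by the cycle C′, on the side of C′ that
  -- does not contain the vertices in ws.
  BoundedBy : Part → List Dart → List Vertex → Part → Set
  BoundedBy K C′ ws K′ = ∀ c →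
    c ∈ᶜ K′ ⇔ (c ∈ᶜ K × (∀ w → w ∈ᴸ ws → ¬ Joined (trace C′) (vert w) c))

  -- Greedy D H C K Hᶠ: the greedy procedure with threshold D, when its current
  -- graph, cycle and bounded subgraph are H, C and K, can end with Hᶠ.
  data Greedy (D : ℚ) (H : Part) (C : List Dart) (K : Part) : Part → Set where
    stop : LocalGeodesic D (trace C) K → Greedy D H C K (H ∪ᵖ trace C)
    cut  : ∀ {u v P Q R K′ Hᶠ} →
           ¬ LocalGeodesic D (trace C) K →
           Subpath C u P v R →
           ¬ ShortestPath K u P v →
           (∀ {u′ v′ P′ R′} → Subpath C u′ P′ v′ R′ → ¬ ShortestPath K u′ P′ v′ →
              length P ≤ length P′) →
           ShortestPath K u Q v →
           -- (C − P) ∪ Q, which has to be a cycle again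
           Cycle whole (Q ++ R) →
           BoundedBy K (Q ++ R) (interior P) K′ →
           Greedy D (H ∪ᵖ trace Q) (Q ++ R) K′ Hᶠ →
           Greedy D H C K Hᶠ

  GreedyFilling : ℚ → Part → List Dart → Part → Set
  GreedyFilling D G′ C H = Greedy D (trace C) C G′ H

  -- The parameter f₀ is the face of G with boundary cycle C; it names the face
  -- C also in the subgraphs of G (when such a subgraph is just C, the
  -- boundary cycle alone does not determine the face).
  FillingFace : Part → Fin nF → Fin nF → Set
  FillingFace H f₀ f = ¬ SameFace H f f₀

  -- The faces of a 2-connected plane graph are bounded by cycles, so the size
  -- of a face is the number of edges on its boundary.
  SizeAtMost : Part → Fin nF → ℕ → Set
  SizeAtMost H f k = ∀ (B : Subset nE) → (∀ e → e ∈ B → OnBoundary H f e) → ∣ B ∣ ≤ k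

  IsFilling : ℕ → List Dart → Fin nF → Part → Set
  IsFilling k C f₀ H = TwoConnected H × IsFaceCycle H C f₀
                     × (∀ f → FillingFace H f₀ f → SizeAtMost H f k)

  Interacts : Part → Fin nF → List Dart → Fin nF → Set
  Interacts H f₀ γ f = MeetsInterior ⊎ SeparatesFromC
    where
    MeetsInterior SeparatesFromC : Set
    MeetsInterior  = ∃[ c ] c ∈ᶜ trace γ × Joined H c (face f)
    SeparatesFromC = ∀ c → Joined H c (face f) → ¬ Joined (trace γ) c (face f₀)

  InteractsWithAtMost : ℕ → Part → Fin nF → List Dart → Set
  InteractsWithAtMost N H f₀ γ = ∀ m (F : Fin m → Fin nF) →
    Injective _≡_ (SameFace H) F →
    (∀ i → FillingFace H f₀ (F i) × Interacts H f₀ γ (F i)) → m ≤ N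

-- Let ∂ A be the set of edges of H with exactly one side in a set A of filling
-- faces.  Then A has at most ∣ ∂ A ∣ faces: if F is the face between Pᵢ and Qᵢ
-- with least i among those in A, then the other sides of the edges of Pᵢ are
-- faces cut off earlier (or C), so Pᵢ ⊆ ∂ A, and removing F from A replaces Pᵢ
-- by edges of Qᵢ, which is shorter; so ∣ ∂ A ∣ drops.  For the set A of filling
-- faces interacting with γ, an edge of ∂ A lies on γ or on the boundary of a
-- face met by an edge of γ, and the latter do not exist when γ ⊆ H.
--
-- No Jordan curve theorem is needed.  That the edges of Pᵢ have a common face on
-- their inner side follows by rotating at the vertices of Pᵢ, because Qᵢ and all
-- later paths stay on the inner side of Cᵢ and off the interior of Pᵢ.  That no
-- later path enters F follows from the definition of the bounded subgraph.
module Submission where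

open import Defs
open import Data.Bool.Base using (Bool; true; false; not)
open import Data.Bool.Properties using (not-involutive) renaming (_≟_ to _≟ᵇ_)
open import Data.Empty using (⊥; ⊥-elim)
open import Data.Fin.Base using (Fin; zero; suc; punchIn)
open import Data.Fin.Properties using (_≟_; any?; punchIn-injective; punchInᵢ≢i; sequence)
open import Data.Fin.Subset as Subset
  using (Subset; inside; outside; _∈_; _∉_; _⊆_; _∪_; _─_; ⋃; ⁅_⁆; _-_; ∣_∣)
open import Data.Fin.Subset.Properties
open import Data.Integer.Base using (+_)
open import Data.List.Base using (List; []; _∷_; _++_; [_]; map; head; length; drop)
open import Data.List.Membership.Propositional renaming (_∈_ to _∈ᴸ_) using ()
open import Data.List.Membership.Propositional.Properties
  using (∈-map⁺; ∈-map⁻; ∈-++⁺ˡ; ∈-++⁺ʳ; ∈-++⁻; ∈-∃++)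
open import Data.List.Properties using (length-++; length-map; map-++; ++-assoc; ++-identityʳ)
open import Data.List.Relation.Binary.Permutation.Propositional using (_↭_; ↭-reflexive; ↭-sym; ↭-trans; ↭⇒↭ₛ)
open import Data.List.Relation.Binary.Permutation.Propositional.Properties
  using (++-comm; drop-∷; ∈-resp-↭; ↭-length) renaming (map⁺ to ↭-map⁺)
open import Data.List.Relation.Binary.Permutation.Setoid.Properties using (Unique-resp-↭)
open import Data.List.Relation.Unary.All as All using (All; []; _∷_)
open import Data.List.Relation.Unary.AllPairs as AllPairs using ([]; _∷_)
open import Data.List.Relation.Unary.Any using (here; there)
open import Data.List.Relation.Unary.Unique.Propositional using (Unique)
open import Data.Nat.Base using (ℕ; zero; suc; _+_; _*_; _≤_; _<_; z≤n; s≤s)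
open import Data.Nat.GeneralisedArithmetic using (iterate)
open import Data.Nat.Properties as ℕ using (_≤?_)
open import Data.Product.Base using (_×_; _,_; proj₁; proj₂; ∃₂; ∃-syntax)
open import Data.Product.Properties using (≡-dec)
open import Data.Rational.Base as ℚ using (ℚ; 1ℚ)
open import Data.Sum.Base as Sum using (_⊎_; inj₁; inj₂; [_,_]′)
open import Data.Vec.Base using ([]; _∷_; lookup; tabulate; here; there)
open import Data.Vec.Properties using (lookup∘tabulate; lookup⇒[]=; []=⇒lookup)
open import Effect.Monad using (RawMonad)
open import Function.Base using (_∘_; case_of_; id)
open import Function.Bundles using (Equivalence; module Inverse)
open import Function.Definitions using (Injective)
open import Relation.Binary.Construct.Closure.Equivalence as Eq using ()
open import Relation.Binary.Construct.Closure.ReflexiveTransitive using (ε; _◅_; _◅◅_)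
open import Relation.Binary.Construct.Closure.Symmetric using (fwd; bwd)
open import Relation.Binary.PropositionalEquality
  using (_≡_; _≢_; refl; sym; trans; cong; subst; subst₂; setoid)
open import Relation.Nullary.Decidable
  using (Dec; map′; yes; no; _×-dec_; _⊎-dec_; ¬?; decidable-stable; ¬¬-excluded-middle; dec-true; does)
open import Relation.Nullary.Negation using (¬_; ¬¬-Monad)

-- Finite sets

-- The obstacle is that the two sides of a cycle are only known locally, at its darts. One of the
-- two mirror images of the embedding is fixed so that `f₀` lies beside the reverses of the darts of
-- `C`; the inner side of the current cycle is then `side d` for its darts `d`. Two invariants of
-- `State` stand in for a separation theorem: no edge of the current graph leaves a corner of the
-- cycle towards the inner side (`wedge`), and no cell of the bounded subgraph off the cycle is
-- reachable from an outer side (`outer`). The count is an induction on the run of the procedure,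
-- for all sets A of faces on the inner side at once. When the procedure stops, that side is a
-- single face, and any edge of the cycle pays for it. The factor k + 1 is what a single dart of γ
-- is charged: 1 for its own edge and k for the boundary of the filling face around it.

satisfying : ∀ {n} {P : Fin n → Set} → (∀ x → Dec (P x)) → Subset n
satisfying P? = tabulate (does ∘ P?)

∈-satisfying⁺ : ∀ {n} {P : Fin n → Set} (P? : ∀ x → Dec (P x)) {x} → P x → x ∈ satisfying P?
∈-satisfying⁺ P? {x} px = lookup⇒[]= x _ (trans (lookup∘tabulate _ x) (dec-true (P? x) px))

∈-satisfying⁻ : ∀ {n} {P : Fin n → Set} (P? : ∀ x → Dec (P x)) {x} → x ∈ satisfying P? → P x
∈-satisfying⁻ P? {x} x∈ with P? x | trans (sym (lookup∘tabulate (does ∘ P?) x)) ([]=⇒lookup x∈)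
... | yes px | _ = px

∣p∪q∣≤∣p∣+∣q∣ : ∀ {n} (p q : Subset n) → ∣ p ∪ q ∣ ≤ ∣ p ∣ + ∣ q ∣
∣p∪q∣≤∣p∣+∣q∣ []            []            = z≤n
∣p∪q∣≤∣p∣+∣q∣ (inside  ∷ p) (inside  ∷ q) =
  s≤s (ℕ.≤-trans (∣p∪q∣≤∣p∣+∣q∣ p q) (ℕ.+-monoʳ-≤ ∣ p ∣ (ℕ.n≤1+n ∣ q ∣)))
∣p∪q∣≤∣p∣+∣q∣ (inside  ∷ p) (outside ∷ q) = s≤s (∣p∪q∣≤∣p∣+∣q∣ p q)
∣p∪q∣≤∣p∣+∣q∣ (outside ∷ p) (inside  ∷ q) =
  subst (suc ∣ p ∪ q ∣ ≤_) (sym (ℕ.+-suc ∣ p ∣ ∣ q ∣)) (s≤s (∣p∪q∣≤∣p∣+∣q∣ p q))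
∣p∪q∣≤∣p∣+∣q∣ (outside ∷ p) (outside ∷ q) = ∣p∪q∣≤∣p∣+∣q∣ p q

∣⋃-map∣≤ : ∀ {A : Set} {n k} (f : A → Subset n) → (∀ x → ∣ f x ∣ ≤ k) →
           ∀ xs → ∣ ⋃ (map f xs) ∣ ≤ k * length xs
∣⋃-map∣≤ {n = n} {k} f f≤ []  = ℕ.≤-trans (ℕ.≤-reflexive (∣⊥∣≡0 n)) z≤n
∣⋃-map∣≤ {k = k} f f≤ (x ∷ xs) = begin
  ∣ f x ∪ ⋃ (map f xs) ∣           ≤⟨ ∣p∪q∣≤∣p∣+∣q∣ (f x) (⋃ (map f xs)) ⟩
  ∣ f x ∣ + ∣ ⋃ (map f xs) ∣       ≤⟨ ℕ.+-mono-≤ (f≤ x) (∣⋃-map∣≤ f f≤ xs) ⟩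
  k + k * length xs                ≡⟨ ℕ.*-suc k (length xs) ⟨
  k * suc (length xs)              ∎
  where open ℕ.≤-Reasoning

∣p─q∣+∣q∣≤∣p∣ : ∀ {n} (p q : Subset n) → q ⊆ p → ∣ p ─ q ∣ + ∣ q ∣ ≤ ∣ p ∣
∣p─q∣+∣q∣≤∣p∣ []            []            q⊆p = z≤n
∣p─q∣+∣q∣≤∣p∣ (inside  ∷ p) (inside  ∷ q) q⊆p =
  subst (_≤ suc ∣ p ∣) (sym (ℕ.+-suc ∣ p ─ q ∣ ∣ q ∣)) (s≤s (∣p─q∣+∣q∣≤∣p∣ p q (drop-∷-⊆ q⊆p)))
∣p─q∣+∣q∣≤∣p∣ (inside  ∷ p) (outside ∷ q) q⊆p = s≤s (∣p─q∣+∣q∣≤∣p∣ p q (drop-∷-⊆ q⊆p))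
∣p─q∣+∣q∣≤∣p∣ (outside ∷ p) (inside  ∷ q) q⊆p = case q⊆p here of λ ()
∣p─q∣+∣q∣≤∣p∣ (outside ∷ p) (outside ∷ q) q⊆p = ∣p─q∣+∣q∣≤∣p∣ p q (drop-∷-⊆ q⊆p)

-- Accounts for the removal of one face: `a` is the old boundary, `b` the path P inside it and `q`
-- the shorter path Q, which may share edges with `a`.
exchange-size : ∀ {n} {p : Subset n} (a b q : Subset n) →
                p ⊆ (a ─ b) ∪ q → b ⊆ a → ∣ q ∣ < ∣ b ∣ → ∣ p ∣ < ∣ a ∣
exchange-size {p = p} a b q p⊆ b⊆a q<b = ℕ.≤-<-trans
  (ℕ.≤-trans (p⊆q⇒∣p∣≤∣q∣ p⊆) (∣p∪q∣≤∣p∣+∣q∣ (a ─ b) q))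
  (ℕ.<-≤-trans (ℕ.+-monoʳ-< (∣ a ─ b ∣) q<b) (∣p─q∣+∣q∣≤∣p∣ a b b⊆a))

unique⇒length≤ : ∀ {n} {xs : List (Fin n)} (p : Subset n) →
                 Unique xs → (∀ {x} → x ∈ᴸ xs → x ∈ p) → length xs ≤ ∣ p ∣
unique⇒length≤ p []            xs⊆p = z≤n
unique⇒length≤ {xs = x ∷ xs} p (x∉xs ∷ uxs) xs⊆p = ℕ.≤-<-trans
  (unique⇒length≤ (p - x) uxs λ y∈ → x∈p∧x≢y⇒x∈p-y (xs⊆p (there y∈)) (All.lookup x∉xs y∈ ∘ sym))
  (x∈p⇒∣p-x∣<∣p∣ (xs⊆p (here refl)))

-- Lists

++-split : ∀ {A : Set} (xs : List A) {ys zs ws} → xs ++ ys ≡ zs ++ ws →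
           (∃[ t ] zs ≡ xs ++ t × ys ≡ t ++ ws) ⊎ (∃[ t ] xs ≡ zs ++ t × ws ≡ t ++ ys)
++-split []       {zs = zs}     eq   = inj₁ (zs , refl , eq)
++-split (x ∷ xs) {zs = []}     eq   = inj₂ (x ∷ xs , refl , sym eq)
++-split (x ∷ xs) {zs = z ∷ zs} eq with refl ← cong head eq
  with ++-split xs {zs = zs} (cong (drop 1) eq)
... | inj₁ (t , refl , q) = inj₁ (t , refl , q)
... | inj₂ (t , refl , q) = inj₂ (t , refl , q)

unique-++⇒disjoint : ∀ {A : Set} {xs ys : List A} {x} →
                     Unique (xs ++ ys) → x ∈ᴸ xs → ¬ x ∈ᴸ ys
unique-++⇒disjoint (x∉ ∷ _)  (here refl) x∈ys = All.lookup x∉ (∈-++⁺ʳ _ x∈ys) refl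
unique-++⇒disjoint (_ ∷ uxs) (there x∈)  x∈ys = unique-++⇒disjoint uxs x∈ x∈ys

unique-prefix : ∀ {A : Set} (xs : List A) {ys} → Unique (xs ++ ys) → Unique xs
unique-prefix []       _          = []
unique-prefix (x ∷ xs) (x∉ ∷ uxs) =
  All.tabulate (λ y∈ → All.lookup x∉ (∈-++⁺ˡ y∈)) ∷ unique-prefix xs uxs

unique-map⇒injective : ∀ {A B : Set} {f : A → B} {xs : List A} → Unique (map f xs) →
                       ∀ {x y} → x ∈ᴸ xs → y ∈ᴸ xs → f x ≡ f y → x ≡ y
unique-map⇒injective (_ ∷ _)   (here refl) (here refl) _  = refl
unique-map⇒injective {f = f} (x∉ ∷ _)  (here refl) (there y∈)  eq = ⊥-elim (All.lookup x∉ (∈-map⁺ f y∈) eq)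
unique-map⇒injective {f = f} (x∉ ∷ _)  (there x∈)  (here refl) eq = ⊥-elim (All.lookup x∉ (∈-map⁺ f x∈) (sym eq))
unique-map⇒injective (_ ∷ uxs) (there x∈)  (there y∈)  eq = unique-map⇒injective uxs x∈ y∈ eq

injective⇒unique-map : ∀ {A B : Set} {f : A → B} {xs : List A} → Unique xs →
                       (∀ {x y} → x ∈ᴸ xs → y ∈ᴸ xs → f x ≡ f y → x ≡ y) → Unique (map f xs)
injective⇒unique-map {xs = []} [] inj = []
injective⇒unique-map {f = f} {x ∷ xs} (x∉ ∷ uxs) inj =
  All.tabulate (λ y∈ eq → case ∈-map⁻ f y∈ of λ where
    (z , z∈ , refl) → All.lookup x∉ z∈ (inj (here refl) (there z∈) eq))
  ∷ injective⇒unique-map uxs λ a b → inj (there a) (there b)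

unique-map⁻ : ∀ {A B : Set} {f : A → B} {xs : List A} → Unique (map f xs) → Unique xs
unique-map⁻ {xs = []} [] = []
unique-map⁻ {f = f} {xs = x ∷ xs} (x∉ ∷ u) =
  All.tabulate (λ y∈ eq → All.lookup x∉ (∈-map⁺ f y∈) (cong f eq)) ∷ unique-map⁻ u

-- The first component of `Subpath C u P v R` is by definition `Rotation C (P ++ R)`.
Rotation : ∀ {A : Set} → List A → List A → Set
Rotation C D = ∃₂ λ xs ys → C ≡ xs ++ ys × ys ++ xs ≡ D

rotation-step : ∀ {A : Set} {C : List A} xs {ys} → Rotation C (xs ++ ys) → Rotation C (ys ++ xs)
rotation-step xs {ys} (A , B , refl , eq) with ++-split B {zs = xs} eq
... | inj₁ (t , refl , refl) = t , ys ++ B , ++-assoc t ys B , ++-assoc ys B t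
... | inj₂ (t , refl , refl) = A ++ xs , t , sym (++-assoc A xs t) , sym (++-assoc t A xs)

rotation-↭ : ∀ {A : Set} {C D : List A} → Rotation C D → C ↭ D
rotation-↭ (xs , ys , refl , refl) = ++-comm xs ys

-- Walks and cycles

module Walks (G : Graph) where
  open GraphNotions G

  _≟ᵈ_ : (d d′ : Dart) → Dec (d ≡ d′)
  _≟ᵈ_ = ≡-dec _≟_ _≟ᵇ_

  rev-rev : ∀ d → rev (rev d) ≡ d
  rev-rev (e , b) = cong (e ,_) (not-involutive b)

  tgt-rev : ∀ d → tgt (rev d) ≡ src d
  tgt-rev d = cong src (rev-rev d)

  same-edge : ∀ (d d′ : Dart) → proj₁ d ≡ proj₁ d′ → d ≡ d′ ⊎ d ≡ rev d′
  same-edge (e , true)  (_ , true)  refl = inj₁ refl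
  same-edge (e , true)  (_ , false) refl = inj₂ refl
  same-edge (e , false) (_ , true)  refl = inj₂ refl
  same-edge (e , false) (_ , false) refl = inj₁ refl

  walk-start : ∀ {K u ds v} → Walk K u ds v → u ∈ verts K
  walk-start (nil u∈)        = u∈
  walk-start (cons _ u∈ _ _) = u∈

  walk-head : ∀ {K u d ds v} → Walk K u (d ∷ ds) v → u ≡ src d
  walk-head (cons s _ _ _) = sym s

  walk-consecutive : ∀ {K u d e ds v} → Walk K u (d ∷ e ∷ ds) v → tgt d ≡ src e
  walk-consecutive (cons _ _ _ w) = walk-head w

  walk-split : ∀ {K u v} A {B} → Walk K u (A ++ B) v → ∃[ w ] Walk K u A w × Walk K w B v
  walk-split []      w = _ , nil (walk-start w) , w
  walk-split (d ∷ A) (cons s u∈ e∈ w) with walk-split A w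
  ... | x , wA , wB = x , cons s u∈ e∈ wA , wB

  walk-++ : ∀ {K u v w A B} → Walk K u A v → Walk K v B w → Walk K u (A ++ B) w
  walk-++ (nil _)           wB = wB
  walk-++ (cons s u∈ e∈ wA) wB = cons s u∈ e∈ (walk-++ wA wB)

  walk-edge : ∀ {K u ds v d} → Walk K u ds v → d ∈ᴸ ds → proj₁ d ∈ edges K
  walk-edge (cons _ _ e∈ _) (here refl) = e∈
  walk-edge (cons _ _ _ w)  (there d∈)  = walk-edge w d∈

  walk-src : ∀ {K u ds v d} → Walk K u ds v → d ∈ᴸ ds → src d ∈ verts K
  walk-src (cons refl u∈ _ _) (here refl) = u∈
  walk-src (cons _ _ _ w)     (there d∈)  = walk-src w d∈

  walk-tgt : ∀ {K u ds v d} → Walk K u ds v → d ∈ᴸ ds → tgt d ∈ verts K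
  walk-tgt (cons _ _ _ w) (here refl) = walk-start w
  walk-tgt (cons _ _ _ w) (there d∈)  = walk-tgt w d∈

  walk-srcs : ∀ {K u ds v} → Walk K u ds v → map src ds ++ [ v ] ≡ u ∷ map tgt ds
  walk-srcs (nil _)                         = refl
  walk-srcs (cons {ds = ds} refl _ _ w) = cong (_ ∷_) (walk-srcs w)

  walk-last : ∀ {K u d ds v} → Walk K u (d ∷ ds) v → ∃[ a ] a ∈ᴸ d ∷ ds × tgt a ≡ v
  walk-last (cons {e = e} {b} _ _ _ (nil _)) = (e , b) , here refl , refl
  walk-last (cons _ _ _ w@(cons _ _ _ _)) with walk-last w
  ... | a , a∈ , eq = a , there a∈ , eq

  walk-tgt-next : ∀ {K u d ds v a} → Walk K u (d ∷ ds) v → a ∈ᴸ d ∷ ds →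
                  tgt a ≡ v ⊎ (∃[ b ] b ∈ᴸ ds × src b ≡ tgt a)
  walk-tgt-next (cons _ _ _ (nil _))           (here refl) = inj₁ refl
  walk-tgt-next (cons _ _ _ (cons s _ _ _))    (here refl) = inj₂ (_ , here refl , s)
  walk-tgt-next (cons _ _ _ w@(cons _ _ _ _))  (there a∈) with walk-tgt-next w a∈
  ... | inj₁ eq            = inj₁ eq
  ... | inj₂ (b , b∈ , eq) = inj₂ (b , there b∈ , eq)

  walk-propagate : ∀ {K u d ds v} (X : Dart → Set) → Walk K u (d ∷ ds) v →
                   (∀ {a b} → a ∈ᴸ d ∷ ds → b ∈ᴸ ds → tgt a ≡ src b → X a → X b) →
                   X d → ∀ {a} → a ∈ᴸ d ∷ ds → X a
  walk-propagate X w pass Xd (here refl) = Xd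
  walk-propagate X (cons _ _ _ w@(cons s _ _ _)) pass Xd (there a∈) =
    walk-propagate X w (λ a b → pass (there a) (there b)) (pass (here refl) (here refl) (sym s) Xd) a∈

  ∪-cases : ∀ {n} {p q : Subset n} {x} → x ∈ p ∪ q → x ∈ p ⊎ x ∈ q
  ∪-cases {p = p} {q} = x∈p∪q⁻ p q

  edge∈trace : ∀ {d ds} → d ∈ᴸ ds → proj₁ d ∈ edges (trace ds)
  edge∈trace {ds = d ∷ ds} (here refl) = x∈p∪q⁺ (inj₁ (x∈⁅x⁆ _))
  edge∈trace {ds = d ∷ ds} (there d∈)  = x∈p∪q⁺ (inj₂ (edge∈trace d∈))

  edge∈trace⁻ : ∀ {e} ds → e ∈ edges (trace ds) → ∃[ d ] d ∈ᴸ ds × e ≡ proj₁ d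
  edge∈trace⁻ []       e∈ = ⊥-elim (∉⊥ e∈)
  edge∈trace⁻ (d ∷ ds) e∈ with ∪-cases e∈
  ... | inj₁ e∈d = d , here refl , x∈⁅y⁆⇒x≡y _ e∈d
  ... | inj₂ e∈′ with edge∈trace⁻ ds e∈′
  ...   | d′ , d′∈ , eq = d′ , there d′∈ , eq

  src∈trace : ∀ {d ds} → d ∈ᴸ ds → src d ∈ verts (trace ds)
  src∈trace {ds = d ∷ ds} (here refl) = x∈p∪q⁺ (inj₁ (x∈p∪q⁺ (inj₁ (x∈⁅x⁆ _))))
  src∈trace {ds = d ∷ ds} (there d∈)  = x∈p∪q⁺ (inj₂ (src∈trace d∈))

  tgt∈trace : ∀ {d ds} → d ∈ᴸ ds → tgt d ∈ verts (trace ds)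
  tgt∈trace {ds = d ∷ ds} (here refl) = x∈p∪q⁺ (inj₁ (x∈p∪q⁺ {p = ⁅ src d ⁆} (inj₂ (x∈⁅x⁆ _))))
  tgt∈trace {ds = d ∷ ds} (there d∈)  = x∈p∪q⁺ (inj₂ (tgt∈trace d∈))

  vert∈trace⁻ : ∀ {x} ds → x ∈ verts (trace ds) → ∃[ d ] d ∈ᴸ ds × (x ≡ src d ⊎ x ≡ tgt d)
  vert∈trace⁻ []       x∈ = ⊥-elim (∉⊥ x∈)
  vert∈trace⁻ (d ∷ ds) x∈ with ∪-cases x∈
  ... | inj₁ x∈d = d , here refl , Sum.map (x∈⁅y⁆⇒x≡y _) (x∈⁅y⁆⇒x≡y _) (∪-cases {p = ⁅ src d ⁆} x∈d)
  ... | inj₂ x∈′ with vert∈trace⁻ ds x∈′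
  ...   | d′ , d′∈ , eq = d′ , there d′∈ , eq

  trace⊆ : ∀ {K u ds v} → Walk K u ds v → trace ds ⊆ᵖ K
  trace⊆ {K} {ds = ds} w = v⊆ , e⊆
    where
    v⊆ : verts (trace ds) ⊆ verts K
    v⊆ x∈ with vert∈trace⁻ ds x∈
    ... | d , d∈ , inj₁ refl = walk-src w d∈
    ... | d , d∈ , inj₂ refl = walk-tgt w d∈
    e⊆ : edges (trace ds) ⊆ edges K
    e⊆ e∈ with edge∈trace⁻ ds e∈
    ... | d , d∈ , refl = walk-edge w d∈

  trace-isSubgraph : ∀ ds → IsSubgraph (trace ds)
  trace-isSubgraph ds e b e∈ with edge∈trace⁻ ds e∈
  ... | d , d∈ , eq with same-edge (e , b) d eq
  ...   | inj₁ refl = src∈trace d∈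
  ...   | inj₂ refl = tgt∈trace d∈

  -- Cancel the common end in `walk-srcs`. This carries distinctness from sources to targets and
  -- gives each dart of a cycle a successor.
  closed-↭ : ∀ {K u ds} → Walk K u ds u → map src ds ↭ map tgt ds
  closed-↭ {u = u} {ds} w =
    drop-∷ (↭-trans (++-comm [ u ] (map src ds)) (↭-reflexive (walk-srcs w)))

  unique-↭ : ∀ {A : Set} {xs ys : List A} → xs ↭ ys → Unique xs → Unique ys
  unique-↭ {A} p = Unique-resp-↭ (setoid A) (↭⇒↭ₛ p)

  rotate-cycle : ∀ {K C D} → Rotation C D → Cycle K C → Cycle K D
  rotate-cycle r@(A , B , refl , refl) ((u , w) , uniq , 3≤) with walk-split A w
  ... | x , wA , wB =
    (x , walk-++ wB wA) , unique-↭ (↭-map⁺ src (rotation-↭ r)) uniq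
    , subst (3 ≤_) (↭-length (rotation-↭ r)) 3≤

  module CycleLemmas {K C} (cyc : Cycle K C) where

    src-injective : ∀ {a b} → a ∈ᴸ C → b ∈ᴸ C → src a ≡ src b → a ≡ b
    src-injective = unique-map⇒injective (proj₁ (proj₂ cyc))

    tgt-injective : ∀ {a b} → a ∈ᴸ C → b ∈ᴸ C → tgt a ≡ tgt b → a ≡ b
    tgt-injective =
      unique-map⇒injective (unique-↭ (closed-↭ (proj₂ (proj₁ cyc))) (proj₁ (proj₂ cyc)))

    successor : ∀ {a} → a ∈ᴸ C → ∃[ b ] b ∈ᴸ C × tgt a ≡ src b
    successor a∈ = ∈-map⁻ src (∈-resp-↭ (↭-sym (closed-↭ (proj₂ (proj₁ cyc)))) (∈-map⁺ tgt a∈))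

    vertex-src : ∀ {x} → x ∈ verts (trace C) → ∃[ d ] d ∈ᴸ C × x ≡ src d
    vertex-src x∈ with vert∈trace⁻ C x∈
    ... | d , d∈ , inj₁ eq   = d , d∈ , eq
    ... | d , d∈ , inj₂ refl = successor d∈

    cycle⊆ : trace C ⊆ᵖ K
    cycle⊆ = trace⊆ (proj₂ (proj₁ cyc))

  -- Rotate the cycle to begin with `a`, `b`, `c`. The only dart of it leaving `tgt a` is `b`, so
  -- `rev a` would be `b`, and then `c` would leave `src a` again.
  rev∉cycle : ∀ {K C} → Cycle K C → ∀ {a} → a ∈ᴸ C → ¬ rev a ∈ᴸ C
  rev∉cycle {K} {C} cyc {a} a∈ ra∈ with X , Y , refl ← ∈-∃++ a∈
    with rotate-cycle (rotation-step X {a ∷ Y} ([] , _ , refl , ++-identityʳ _)) cyc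
       | ∈-resp-↭ (++-comm X (a ∷ Y)) ra∈
  ... | (u , w) , uniq , 3≤ | ra∈′ = go (Y ++ X) w uniq 3≤ ra∈′
    where
    go : ∀ Z {u} → Walk K u (a ∷ Z) u → Unique (map src (a ∷ Z)) → 3 ≤ suc (length Z) → ¬ rev a ∈ᴸ a ∷ Z
    go (_ ∷ [])     _ _ (s≤s (s≤s ())) _
    go Z@(b ∷ c ∷ _) (cons _ _ _ (cons sb _ _ (cons sc _ _ _))) uniq@((_ ∷ a≢c ∷ _) ∷ _) _ ra∈Z =
      a≢c (sym (trans sc (trans (cong tgt b≡ra) (tgt-rev a))))
      where
      b≡ra : b ≡ rev a
      b≡ra = unique-map⇒injective uniq (there (here refl)) ra∈Z sb

  edge-injective : ∀ {K C} → Cycle K C → ∀ {a b} → a ∈ᴸ C → b ∈ᴸ C → proj₁ a ≡ proj₁ b → a ≡ b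
  edge-injective cyc {a} {b} a∈ b∈ eq with same-edge a b eq
  ... | inj₁ r    = r
  ... | inj₂ refl = ⊥-elim (rev∉cycle cyc b∈ a∈)

  walk-restrict : ∀ {K L u ds v} → Walk K u ds v → u ∈ verts L →
                  (∀ {d} → d ∈ᴸ ds → proj₁ d ∈ edges L × tgt d ∈ verts L) → Walk L u ds v
  walk-restrict (nil _)        u∈ in-L = nil u∈
  walk-restrict (cons s _ _ w) u∈ in-L =
    cons s u∈ (proj₁ (in-L (here refl))) (walk-restrict w (proj₂ (in-L (here refl))) (in-L ∘ there))

  trace-incident : ∀ {x} ds → x ∈ verts (trace ds) → ∃[ d ] src d ≡ x × proj₁ d ∈ edges (trace ds)
  trace-incident ds x∈ with vert∈trace⁻ ds x∈
  ... | d , d∈ , inj₁ refl = d , refl , edge∈trace d∈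
  ... | d , d∈ , inj₂ refl = rev d , refl , edge∈trace d∈

  trace-edge-cases : ∀ d ds → proj₁ d ∈ edges (trace ds) → d ∈ᴸ ds ⊎ rev d ∈ᴸ ds
  trace-edge-cases d ds e∈ with edge∈trace⁻ ds e∈
  ... | d′ , d′∈ , eq with same-edge d′ d (sym eq)
  ...   | inj₁ refl = inj₁ d′∈
  ...   | inj₂ refl = inj₂ d′∈

  walk-target : ∀ {K L u ds v v′} → Walk K u ds v → Walk L u ds v′ → v ≡ v′
  walk-target (nil _)        (nil _)         = refl
  walk-target (cons _ _ _ w) (cons _ _ _ w′) = walk-target w w′

  walk-split-at : ∀ {K u Q v x} → Walk K u Q v → x ∈ verts (trace Q) →
                  ∃₂ λ A B → Q ≡ A ++ B × Walk K u A x × Walk K x B v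
  walk-split-at {Q = Q} w x∈ with vert∈trace⁻ Q x∈
  ... | q , q∈ , at with ∈-∃++ q∈
  ...   | A , B , refl with walk-split A w | at
  ...     | _ , wA , wB@(cons refl _ _ _) | inj₁ refl = A , q ∷ B , refl , wA , wB
  ...     | _ , wA , cons refl s∈ e∈ wB   | inj₂ refl =
    A ++ [ q ] , B , sym (++-assoc A [ q ] B) , walk-++ wA (cons refl s∈ e∈ (nil (walk-start wB))) , wB

  cycle-propagate : ∀ {K C c} (X : Dart → Set) → Cycle K C →
                    (∀ {a b} → a ∈ᴸ C → b ∈ᴸ C → tgt a ≡ src b → X a → X b) →
                    c ∈ᴸ C → X c → ∀ {d} → d ∈ᴸ C → X d
  cycle-propagate {c = c} X cyc pass c∈ Xc d∈ with A , B , refl ← ∈-∃++ c∈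
    with rotate-cycle (A , c ∷ B , refl , refl) cyc
  ... | (_ , closed) , _ =
    walk-propagate X closed (λ a∈ b∈ → pass (back a∈) (back (there b∈))) Xc (∈-resp-↭ (++-comm A (c ∷ B)) d∈)
    where
    back : ∀ {a} → a ∈ᴸ (c ∷ B) ++ A → a ∈ᴸ A ++ (c ∷ B)
    back = ∈-resp-↭ (++-comm (c ∷ B) A)

  cycle-dart : ∀ {K C} → Cycle K C → ∃[ c ] c ∈ᴸ C
  cycle-dart {C = c ∷ _} _ = c , here refl
  cycle-dart {C = []} (_ , _ , ())

  ∣traceᵉ∣≤ : ∀ ds → ∣ edges (trace ds) ∣ ≤ length ds
  ∣traceᵉ∣≤ ds = ℕ.≤-trans
    (∣⋃-map∣≤ (⁅_⁆ ∘ proj₁) (ℕ.≤-reflexive ∘ ∣⁅x⁆∣≡1 ∘ proj₁) ds) (ℕ.≤-reflexive (ℕ.*-identityˡ _))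

-- Cells and rotations

module Cells (G : Graph) (S : SphereEmbedding G) where
  open PlaneNotions G S
  open Walks G

  infix 4 _⊆ᶜ_
  _⊆ᶜ_ : Part → Part → Set
  K ⊆ᶜ L = ∀ {c} → c ∈ᶜ K → c ∈ᶜ L

  cellwise : ∀ {K L} → K ⊆ᵖ L → K ⊆ᶜ L
  cellwise (v⊆ , e⊆) {vert _} = v⊆
  cellwise (v⊆ , e⊆) {edge _} = e⊆
  cellwise (v⊆ , e⊆) {face _} = id

  ∪ᶜ-cases : ∀ {K L} c → c ∈ᶜ K ∪ᵖ L → c ∈ᶜ K ⊎ c ∈ᶜ L
  ∪ᶜ-cases (vert _) = ∪-cases
  ∪ᶜ-cases (edge _) = ∪-cases

  ∪ᶜ-left : ∀ {K L} → K ⊆ᶜ K ∪ᵖ L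
  ∪ᶜ-left {c = vert _} x = x∈p∪q⁺ (inj₁ x)
  ∪ᶜ-left {c = edge _} x = x∈p∪q⁺ (inj₁ x)

  ∪ᶜ-right : ∀ K {L} → L ⊆ᶜ K ∪ᵖ L
  ∪ᶜ-right K {c = vert _} x = x∈p∪q⁺ {p = verts K} (inj₂ x)
  ∪ᶜ-right K {c = edge _} x = x∈p∪q⁺ {p = edges K} (inj₂ x)

  joined-sym : ∀ {K a b} → Joined K a b → Joined K b a
  joined-sym = Eq.symmetric _

  joined-≺ : ∀ {K a b} → a ≺ b → ¬ a ∈ᶜ K → ¬ b ∈ᶜ K → Joined K a b
  joined-≺ a≺b a∉ b∉ = fwd (a≺b , a∉ , b∉) ◅ ε

  joined-member : ∀ {K a b} → Joined K a b → a ∈ᶜ K → a ≡ b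
  joined-member ε                       a∈ = refl
  joined-member (fwd (_ , a∉ , _) ◅ _)  a∈ = ⊥-elim (a∉ a∈)
  joined-member (bwd (_ , _ , a∉) ◅ _)  a∈ = ⊥-elim (a∉ a∈)

  face-joined∉ : ∀ {K f} c → Joined K (face f) c → ¬ c ∈ᶜ K
  face-joined∉ c j c∈ with refl ← joined-member (joined-sym j) c∈ = c∈

  joined-mono : ∀ {K L a b} → L ⊆ᶜ K → Joined K a b → Joined L a b
  joined-mono L⊆K = Eq.map λ (a≺b , a∉ , b∉) → a≺b , a∉ ∘ L⊆K , b∉ ∘ L⊆K

  -- The chain from `a` to `b` stays in the component of `a` off `K`; if this component misses `L`,
  -- every step is also a step off `L`.
  joined-avoid : ∀ {K L a b} → Joined K a b → (∀ c → Joined K a c → ¬ c ∈ᶜ L) → Joined L a b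
  joined-avoid ε avoid = ε
  joined-avoid (s@(fwd (a≺c , _)) ◅ j) avoid =
    fwd (a≺c , avoid _ ε , avoid _ (s ◅ ε)) ◅ joined-avoid j λ c → avoid c ∘ (s ◅_)
  joined-avoid (s@(bwd (c≺a , _)) ◅ j) avoid =
    bwd (c≺a , avoid _ (s ◅ ε) , avoid _ ε) ◅ joined-avoid j λ c → avoid c ∘ (s ◅_)

  -- One of the two mirror images of the embedding: the darts at a vertex are
  -- permuted by rotate, and side d is the face on a fixed side of d.
  record Orientation : Set where
    field
      rotate        : Dart → Dart
      side          : Dart → Fin nF
      rotate-src    : ∀ d → src (rotate d) ≡ src d
      rotate-cyclic : ∀ {d d′} → src d ≡ src d′ → ∃[ n ] iterate rotate d n ≡ d′
      side-rotate   : ∀ d → side (rotate d) ≡ side (rev d)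
      side-onto     : ∀ f → ∃[ d ] side d ≡ f
      vert≺side     : ∀ d → vert (src d) ≺ face (side d)
      edge≺side     : ∀ d → edge (proj₁ d) ≺ face (side d)

  positive : Orientation
  positive = record
    { rotate        = turn
    ; side          = faceOf
    ; rotate-src    = turn-src
    ; rotate-cyclic = turn-cyclic
    ; side-rotate   = λ d → trans (cong (faceOf ∘ turn) (sym (rev-rev d))) (face-next (rev d))
    ; side-onto     = face-onto
    ; vert≺side     = vert-face
    ; edge≺side     = λ (e , b) → edge-face e b
    }

  -- Reversing the rotation exchanges the two sides of every dart. Both mirror images are needed
  -- because `C` may run around `f₀` in either direction.
  negative : Orientation
  negative = record
    { rotate        = unturn
    ; side          = faceOf ∘ rev
    ; rotate-src    = λ d → trans (sym (turn-src (unturn d))) (cong src (turn-unturn d))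
    ; rotate-cyclic = λ {d} {d′} eq → let n , it = turn-cyclic (sym eq) in n , undo n it
    ; side-rotate   = λ d → trans (sym (face-turn (unturn d)))
                            (trans (cong faceOf (turn-unturn d)) (cong faceOf (sym (rev-rev d))))
    ; side-onto     = λ f → let d , eq = face-onto f in rev d , trans (cong faceOf (rev-rev d)) eq
    ; vert≺side     = λ d → subst₂ (λ x f → vert x ≺ face f) (turn-src d) (face-turn d) (vert-face (turn d))
    ; edge≺side     = λ (e , b) → edge-face e (not b)
    }
    where
    unturn : Dart → Dart
    unturn = Inverse.from rot
    turn-unturn : ∀ d → turn (unturn d) ≡ d
    turn-unturn d = Inverse.inverseˡ rot refl
    unturn-turn : ∀ d → unturn (turn d) ≡ d
    unturn-turn d = Inverse.inverseʳ rot refl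
    face-turn : ∀ d → faceOf (turn d) ≡ faceOf (rev d)
    face-turn d = trans (cong (faceOf ∘ turn) (sym (rev-rev d))) (face-next (rev d))
    iterate-suc : ∀ (f : Dart → Dart) d n → iterate f d (suc n) ≡ f (iterate f d n)
    iterate-suc f d zero    = refl
    iterate-suc f d (suc n) = iterate-suc f (f d) n
    undo : ∀ n {d d′} → iterate turn d′ n ≡ d → iterate unturn d n ≡ d′
    undo zero    refl = refl
    undo (suc n) {d′ = d′} refl =
      trans (iterate-suc unturn (iterate turn (turn d′) n) n)
            (trans (cong unturn (undo n {d′ = turn d′} refl)) (unturn-turn d′))

  module Sweeping (O : Orientation) where
    open Orientation O public

    -- Sweep K x y: rotating at a vertex from the dart x, the dart y is reached
    -- before any other dart of K.
    data Sweep (K : Part) : Dart → Dart → Set where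
      stop : ∀ {x y} → rotate x ≡ y → Sweep K x y
      skip : ∀ {x y} → proj₁ (rotate x) ∉ edges K → Sweep K (rotate x) y → Sweep K x y

    joined-across : ∀ {K} d → proj₁ d ∉ edges K → Joined K (face (side d)) (face (side (rev d)))
    joined-across d d∉ = bwd (edge≺side d , d∉ , id) ◅ fwd (edge≺side (rev d) , d∉ , id) ◅ ε

    -- By `side-rotate`, the corner between `x` and `rotate x` lies in the face `side (rev x)`,
    -- which is also `side (rotate x)`. The skipped darts are not in `K`, so successive corners are
    -- joined across them.
    sweep-joined : ∀ {K x y} → Sweep K x y → Joined K (face (side (rev x))) (face (side y))
    sweep-joined {K} {x} (stop refl) =
      subst (λ f → Joined K (face f) (face (side (rotate x)))) (side-rotate x) ε
    sweep-joined {K} {x} {y} (skip r∉ s) =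
      subst (λ f → Joined K (face f) (face (side y))) (side-rotate x)
            (joined-across (rotate x) r∉ ◅◅ sweep-joined s)

    wedge-joined : ∀ {K a b} → Sweep K (rev a) b → Joined K (face (side a)) (face (side b))
    wedge-joined {K} {a} {b} s =
      subst (λ d → Joined K (face (side d)) (face (side b))) (rev-rev a) (sweep-joined s)

    sweep-extend : ∀ {K L x y} → (∀ d → src d ≡ src x → proj₁ d ∈ edges L → proj₁ d ∈ edges K) →
                   Sweep K x y → Sweep L x y
    sweep-extend L⊆K (stop eq) = stop eq
    sweep-extend {x = x} L⊆K (skip r∉ s) =
      skip (r∉ ∘ L⊆K _ (rotate-src x)) (sweep-extend (λ d eq → L⊆K d (trans eq (rotate-src x))) s)

    sweep-split : ∀ {K L x y} q → src q ≡ src x →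
                  (∀ d → src d ≡ src x → proj₁ d ∈ edges L → proj₁ d ∈ edges K ⊎ d ≡ q) →
                  Sweep K x y → Sweep L x y ⊎ (Sweep L x q × Sweep L q y)
    sweep-split q eq L⊆K (stop r) = inj₁ (stop r)
    sweep-split {K} {L} {x} q eq L⊆K (skip r∉ s)
      with rotate x ≟ᵈ q
         | sweep-split {K} {L} q (trans eq (sym (rotate-src x))) (λ d e → L⊆K d (trans e (rotate-src x))) s
    ... | yes refl | inj₁ s′       = inj₂ (stop refl , s′)
    ... | yes refl | inj₂ (_ , s′) = inj₂ (stop refl , s′)
    ... | no r≢q   | rec = Sum.map (skip r∉L) (λ (s₁ , s₂) → skip r∉L s₁ , s₂) rec
      where
      r∉L : proj₁ (rotate x) ∉ edges L
      r∉L = [ r∉ , r≢q ]′ ∘ L⊆K _ (rotate-src x)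

    -- The number of rotations leading from `x` to `y` need not be minimal, so the orbit may pass
    -- `x` again on the way. Hence `go` returns a sweep from the current dart or, after such a
    -- passage, one from `x`.
    sweep-exists : ∀ {K x y} → src x ≡ src y → x ≢ y →
                   (∀ d → src d ≡ src x → proj₁ d ∈ edges K → d ≡ x ⊎ d ≡ y) → Sweep K x y
    sweep-exists {K} {x} {y} sx≡sy x≢y only with rotate-cyclic sx≡sy
    ... | n , it = [ ⊥-elim ∘ x≢y , [ id , id ]′ ]′ (go n x refl it)
      where
      go : ∀ n z → src z ≡ src x → iterate rotate z n ≡ y → z ≡ y ⊎ (Sweep K z y ⊎ Sweep K x y)
      go zero    z _  it = inj₁ it
      go (suc n) z sz it with rotate z ≟ᵈ y | proj₁ (rotate z) ∈? edges K | go n (rotate z) (trans (rotate-src z) sz) it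
      ... | yes r | _      | _               = inj₂ (inj₁ (stop r))
      ... | no r≢ | _      | inj₁ r          = ⊥-elim (r≢ r)
      ... | no r≢ | _      | inj₂ (inj₂ s)   = inj₂ (inj₂ s)
      ... | no r≢ | no r∉  | inj₂ (inj₁ s)   = inj₂ (inj₁ (skip r∉ s))
      ... | no r≢ | yes r∈ | inj₂ (inj₁ s)   with only _ (trans (rotate-src z) sz) r∈
      ...   | inj₁ r≡x = inj₂ (inj₂ (subst (λ d → Sweep K d y) r≡x s))
      ...   | inj₂ r≡y = ⊥-elim (r≢ r≡y)

    rotate-induction : ∀ {d₀} (X : Dart → Set) → X d₀ → (∀ {d} → src d ≡ src d₀ → X d → X (rotate d)) →
                       ∀ d → src d ≡ src d₀ → X d
    rotate-induction {d₀} X x₀ step d eq with rotate-cyclic (sym eq)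
    ... | n , it = go n d₀ refl x₀ it
      where
      go : ∀ n z → src z ≡ src d₀ → X z → iterate rotate z n ≡ d → X d
      go zero    z _  x refl = x
      go (suc n) z sz x it   = go n (rotate z) (trans (rotate-src z) sz) (step sz x) it

    -- The hypothesis on Joined says that q does not point to the outer side of
    -- the corner (a , b) of C.
    sweep-insert : ∀ {C K L a b q} →
      (∀ d → src d ≡ src b → proj₁ d ∈ edges C → d ≡ b ⊎ d ≡ rev a) →
      tgt a ≡ src b → proj₁ a ∈ edges C → Sweep K (rev a) b →
      src q ≡ src b → proj₁ q ∉ edges C → proj₁ q ∈ edges L →
      ¬ Joined C (face (side (rev b))) (edge (proj₁ q)) →
      (∀ d → src d ≡ src b → proj₁ d ∈ edges L → proj₁ d ∈ edges K ⊎ d ≡ q) →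
      Sweep L (rev a) q × Sweep L q b
    sweep-insert {C} {K} {L} {a} {b} {q} corner a→b a∈C wedge sq q∉C q∈L inner L⊆K
      with sweep-split {K} {L} q (trans sq (sym a→b)) (λ d e → L⊆K d (trans e a→b)) wedge
    ... | inj₂ sweeps = sweeps
    ... | inj₁ s      = ⊥-elim (impossible (rotate-induction X (inj₁ ε) step q sq))
      where
      -- Suppose that the sweep misses `q`, and rotate on from `b`. Up to `rev a` all faces are
      -- joined to the outer side; from `rev a` on, the remaining sweep back to `b` meets no dart of
      -- `L`. `X` says which phase `d` is in, and `q` fits neither.
      X : Dart → Set
      X d = Joined C (face (side (rev b))) (face (side (rev d)))
          ⊎ (proj₁ d ∉ edges L ⊎ d ≡ rev a) × Sweep L d b
      step : ∀ {d} → src d ≡ src b → X d → X (rotate d)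
      step {d} sd (inj₂ (_ , stop refl))  = inj₁ ε
      step {d} sd (inj₂ (_ , skip r∉ s′)) = inj₂ (inj₁ r∉ , s′)
      step {d} sd (inj₁ j) with proj₁ (rotate d) ∈? edges C
      ... | yes r∈ with corner (rotate d) (trans (rotate-src d) sd) r∈
      ...   | inj₁ refl = inj₁ ε
      ...   | inj₂ r≡   = inj₂ (inj₂ r≡ , subst (λ x → Sweep L x b) (sym r≡) s)
      step {d} sd (inj₁ j) | no r∉ =
        inj₁ (j ◅◅ subst (λ f → Joined C (face f) (face (side (rev (rotate d))))) (side-rotate d)
                         (joined-across (rotate d) r∉))
      impossible : ¬ X q
      impossible (inj₁ j)               = inner (j ◅◅ bwd (edge≺side (rev q) , q∉C , id) ◅ ε)
      impossible (inj₂ (inj₁ q∉L , _))  = q∉L q∈L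
      impossible (inj₂ (inj₂ refl , _)) = q∉C a∈C

    module _ {K} (sub : IsSubgraph K)
             (incident : ∀ {x} → x ∈ verts K → ∃[ d ] src d ≡ x × proj₁ d ∈ edges K) where

      private
        Seen : Cell → Set
        Seen c = ∃[ d ] proj₁ d ∈ edges K × Joined K c (face (side d))

        -- Rotate from a dart of `K` at `x`. Passing a dart outside `K` stays in the same component;
        -- passing a dart of `K` enters a face that has this dart beside it.
        around : ∀ {x} → x ∈ verts K → ∀ d → src d ≡ x → Seen (face (side d))
        around x∈ d sd with incident x∈
        ... | h , sh , h∈ = rotate-induction (Seen ∘ face ∘ side) (h , h∈ , ε) (λ _ → step) d (trans sd (sym sh))
          where
          step : ∀ {d} → Seen (face (side d)) → Seen (face (side (rotate d)))
          step {d} (g , g∈ , j) rewrite side-rotate d with proj₁ d ∈? edges K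
          ... | yes d∈ = rev d , d∈ , ε
          ... | no  d∉ = g , g∈ , joined-sym (joined-across d d∉) ◅◅ j

        Reached : Vertex → Set
        Reached x = x ∈ verts K ⊎ (x ∉ verts K × Seen (vert x))

        cross : ∀ d → Reached (src d) → Reached (tgt d)
        cross d r with proj₁ d ∈? edges K | tgt d ∈? verts K
        ... | _      | yes t∈ = inj₁ t∈
        ... | yes d∈ | no _   = inj₁ (sub _ _ d∈)
        ... | no  d∉ | no t∉  = inj₂ (t∉ , go r)
          where
          t~d : Joined K (vert (tgt d)) (edge (proj₁ d))
          t~d = joined-≺ (vert-edge (proj₁ d) (not (proj₂ d))) t∉ d∉
          go : Reached (src d) → Seen (vert (tgt d))
          go (inj₁ s∈) with around s∈ d refl
          ... | g , g∈ , j = g , g∈ , t~d ◅◅ joined-≺ (edge≺side d) d∉ id ◅◅ j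
          go (inj₂ (s∉ , g , g∈ , j)) =
            g , g∈ , t~d ◅◅ joined-sym (joined-≺ (vert-edge (proj₁ d) (proj₂ d)) s∉ d∉) ◅◅ j

        reach : ∀ {L x ds y} → Walk L x ds y → Reached x → Reached y
        reach (nil _)           r = r
        reach (cons refl _ _ w) r = reach w (cross _ r)

      -- As `G` is connected, a walk leads from `K` to a vertex of `f`. Every vertex on it lies in
      -- `K` or in a component off `K` that has an edge of `K` beside it, and at the end this holds
      -- for `f`.
      joined-to-subgraph : ∀ {h} → proj₁ h ∈ edges K → ∀ f →
                           ∃[ d ] proj₁ d ∈ edges K × Joined K (face f) (face (side d))
      joined-to-subgraph {h} h∈ f with side-onto f
      ... | d , refl with reach (proj₂ (connected {src h} {src d} ∈⊤ ∈⊤)) (inj₁ (sub _ _ h∈))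
      ...   | inj₁ s∈                  = around s∈ d refl
      ...   | inj₂ (s∉ , g , g∈ , j) = g , g∈ , joined-sym (joined-≺ (vert≺side d) s∉ id) ◅◅ j

-- The greedy procedure

module Procedure (G : Graph) (S : SphereEmbedding G) (O : Cells.Orientation G S) where
  open PlaneNotions G S
  open Walks G
  open Cells G S
  open Sweeping O

  -- What holds whenever the current graph, cycle and bounded subgraph of the
  -- procedure are H, C and K; the sides of the darts of C are those towards K.
  record State (H : Part) (C : List Dart) (K : Part) : Set where
    field
      cycle    : Cycle K C
      sub      : IsSubgraph H
      incident : ∀ {x} → x ∈ verts H → ∃[ d ] src d ≡ x × proj₁ d ∈ edges H
      C⊆H      : trace C ⊆ᶜ H
      H∩K⊆C    : ∀ {c} → c ∈ᶜ H → c ∈ᶜ K → c ∈ᶜ trace C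
      -- With `wedge-joined` this puts the inner sides of all darts of `C` into one face of `H`.
      wedge    : ∀ {a b} → a ∈ᴸ C → b ∈ᴸ C → tgt a ≡ src b → Sweep H (rev a) b
      -- This is what forces a later path, which runs in `K`, to leave `C` through an inner corner.
      outer    : ∀ {d c} → d ∈ᴸ C → c ∈ᶜ K → ¬ c ∈ᶜ trace C →
                 ¬ Joined (trace C) (face (side (rev d))) c

  corner-darts : ∀ {K C a b} → Cycle K C → a ∈ᴸ C → b ∈ᴸ C → tgt a ≡ src b →
                 ∀ d → src d ≡ src b → proj₁ d ∈ edges (trace C) → d ≡ b ⊎ d ≡ rev a
  corner-darts {C = C} cyc a∈ b∈ a→b d sd e∈ with trace-edge-cases d C e∈
  ... | inj₁ d∈  = inj₁ (CycleLemmas.src-injective cyc d∈ b∈ sd)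
  ... | inj₂ rd∈ = inj₂ (trans (sym (rev-rev d)) (cong rev
                     (CycleLemmas.tgt-injective cyc rd∈ a∈ (trans (tgt-rev d) (trans sd (sym a→b))))))

  corner-sweeps : ∀ {K C a b L} → Cycle K C → a ∈ᴸ C → b ∈ᴸ C → tgt a ≡ src b →
                  (∀ d → src d ≡ src b → proj₁ d ∈ edges L → proj₁ d ∈ edges (trace C)) →
                  Sweep L (rev a) b × Sweep L b (rev a)
  corner-sweeps {a = a} {b} {L} cyc a∈ b∈ a→b L⊆C =
      sweep-exists a→b ra≢b (λ d eq e∈ → Sum.swap (corner d (trans eq a→b) e∈))
    , sweep-exists (sym a→b) (ra≢b ∘ sym) corner
    where
    ra≢b : rev a ≢ b
    ra≢b refl = rev∉cycle cyc a∈ b∈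
    corner : ∀ d → src d ≡ src b → proj₁ d ∈ edges L → d ≡ b ⊎ d ≡ rev a
    corner d eq e∈ = corner-darts cyc a∈ b∈ a→b d eq (L⊆C d eq e∈)

  -- One iteration. That `P` has a second dart `p₂` provides the interior vertex `src p₂`, by which
  -- `BoundedBy` recognises the discarded side of `C′`.
  module Cut
    {H C K K′ u v p₁ p₂ Ps q₁ Qs r₁ Rs} (st : State H C K)
    (rotation : Rotation C ((p₁ ∷ p₂ ∷ Ps) ++ r₁ ∷ Rs))
    (walkP : Walk K u (p₁ ∷ p₂ ∷ Ps) v) (walkQ : Walk K u (q₁ ∷ Qs) v) (walkR : Walk K v (r₁ ∷ Rs) u)
    (avoid : ∀ {p} → p ∈ᴸ p₂ ∷ Ps → src p ∉ verts (trace (q₁ ∷ Qs)))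
    (cycle′ : Cycle whole (q₁ ∷ Qs ++ r₁ ∷ Rs))
    (bounded : BoundedBy K (q₁ ∷ Qs ++ r₁ ∷ Rs) (interior (p₁ ∷ p₂ ∷ Ps)) K′)
    where
    open State st

    P Q R : List Dart
    P = p₁ ∷ p₂ ∷ Ps
    Q = q₁ ∷ Qs
    R = r₁ ∷ Rs

    C′ : List Dart
    C′ = Q ++ R

    H′ : Part
    H′ = H ∪ᵖ trace Q

    cycle₀ : Cycle K (P ++ R)
    cycle₀ = rotate-cycle rotation cycle

    module Old = CycleLemmas cycle₀
    module New = CycleLemmas cycle′

    C⇒P⊎R : ∀ {d} → d ∈ᴸ C → d ∈ᴸ P ⊎ d ∈ᴸ R
    C⇒P⊎R d∈ = ∈-++⁻ P (∈-resp-↭ (rotation-↭ rotation) d∈)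

    P⇒C : ∀ {d} → d ∈ᴸ P → d ∈ᴸ C
    P⇒C d∈ = ∈-resp-↭ (↭-sym (rotation-↭ rotation)) (∈-++⁺ˡ d∈)

    R⇒C : ∀ {d} → d ∈ᴸ R → d ∈ᴸ C
    R⇒C d∈ = ∈-resp-↭ (↭-sym (rotation-↭ rotation)) (∈-++⁺ʳ P d∈)

    Q⇒C′ : ∀ {d} → d ∈ᴸ Q → d ∈ᴸ C′
    Q⇒C′ = ∈-++⁺ˡ

    R⇒C′ : ∀ {d} → d ∈ᴸ R → d ∈ᴸ C′
    R⇒C′ = ∈-++⁺ʳ Q

    srcs-disjoint : ∀ X {a b} → Unique (map src (X ++ R)) → a ∈ᴸ X → b ∈ᴸ R → src a ≢ src b
    srcs-disjoint X uniq a∈ b∈ eq =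
      unique-++⇒disjoint (subst Unique (map-++ src X R) uniq) (∈-map⁺ src a∈)
        (subst (_∈ᴸ map src R) (sym eq) (∈-map⁺ src b∈))

    P#R : ∀ {a b} → a ∈ᴸ P → b ∈ᴸ R → src a ≢ src b
    P#R = srcs-disjoint P (proj₁ (proj₂ cycle₀))

    Q#R : ∀ {a b} → a ∈ᴸ Q → b ∈ᴸ R → src a ≢ src b
    Q#R = srcs-disjoint Q (proj₁ (proj₂ cycle′))

    u≡p₁ : u ≡ src p₁
    u≡p₁ = walk-head walkP

    u≡q₁ : u ≡ src q₁
    u≡q₁ = walk-head walkQ

    v≡r₁ : v ≡ src r₁
    v≡r₁ = walk-head walkR

    R-src∈H : ∀ {d} → d ∈ᴸ R → src d ∈ verts H
    R-src∈H d∈ = C⊆H {vert _} (src∈trace (R⇒C d∈))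

    R-tgt∈H : ∀ {d} → d ∈ᴸ R → tgt d ∈ verts H
    R-tgt∈H d∈ = C⊆H {vert _} (tgt∈trace (R⇒C d∈))

    -- Such a vertex is in `K`, so if it were in `H` it would be on `C`. It is not on `R`, since
    -- `Q ++ R` is a cycle, not in the interior of `P` by `avoid`, and not `u`, where `Q` starts.
    Qs-src∉H : ∀ {q} → q ∈ᴸ Qs → src q ∉ verts H
    Qs-src∉H {q} q∈ s∈H with CycleLemmas.vertex-src cycle (H∩K⊆C {vert _} s∈H (walk-src walkQ (there q∈)))
    ... | d , d∈C , eq with C⇒P⊎R d∈C
    ...   | inj₂ d∈R           = Q#R (there q∈) d∈R eq
    ...   | inj₁ (there d∈Ps)  = avoid d∈Ps (subst (_∈ verts (trace Q)) eq (src∈trace {ds = Q} (there q∈)))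
    ...   | inj₁ (here refl) with proj₁ (proj₂ cycle′)
    ...     | q₁∉ ∷ _ = All.lookup q₁∉ (∈-map⁺ src (∈-++⁺ˡ q∈)) (sym (trans eq (trans (sym u≡p₁) u≡q₁)))

    Q-src∈H⇒u : ∀ {q} → q ∈ᴸ Q → src q ∈ verts H → src q ≡ u
    Q-src∈H⇒u (here refl) _   = sym u≡q₁
    Q-src∈H⇒u (there q∈)  s∈H = ⊥-elim (Qs-src∉H q∈ s∈H)

    Q-tgt∈H⇒v : ∀ {q} → q ∈ᴸ Q → tgt q ∈ verts H → tgt q ≡ v
    Q-tgt∈H⇒v q∈ t∈H with walk-tgt-next walkQ q∈
    ... | inj₁ eq            = eq
    ... | inj₂ (q′ , q′∈ , eq) = ⊥-elim (Qs-src∉H q′∈ (subst (_∈ verts H) (sym eq) t∈H))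

    -- Such an edge would lie on `C` and lead from `u` to `v`. As a dart of `C` leaving `u` it is
    -- `p₁`, but `P` does not end there; reversed it is `r₁`, and then `C′` contains a dart together
    -- with its reverse.
    Q-edge∉H : ∀ {q} → q ∈ᴸ Q → proj₁ q ∉ edges H
    Q-edge∉H {q} q∈ e∈H with edge∈trace⁻ C (H∩K⊆C {edge _} e∈H (walk-edge walkQ q∈))
    ... | d , d∈C , eq with same-edge d q (sym eq) | ∈-resp-↭ (rotation-↭ rotation) d∈C
    ...   | inj₁ refl | d∈ = P#R (there (here refl)) (here refl) (trans (sym q→p₂) (trans tq≡v v≡r₁))
      where
      tq≡v : tgt q ≡ v
      tq≡v = Q-tgt∈H⇒v q∈ (sub _ _ e∈H)
      q≡p₁ : q ≡ p₁
      q≡p₁ = Old.src-injective d∈ (here refl) (trans (Q-src∈H⇒u q∈ (sub _ _ e∈H)) u≡p₁)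
      q→p₂ : tgt q ≡ src p₂
      q→p₂ = trans (cong tgt q≡p₁) (walk-consecutive walkP)
    ...   | inj₂ refl | d∈ =
      rev∉cycle cycle′ (Q⇒C′ q∈) (subst (_∈ᴸ C′) (sym rq≡r₁) (R⇒C′ (here refl)))
      where
      rq≡r₁ : rev q ≡ r₁
      rq≡r₁ = Old.src-injective d∈ (∈-++⁺ʳ P (here refl)) (trans (Q-tgt∈H⇒v q∈ (sub _ _ e∈H)) v≡r₁)

    P-edge∉C′ : ∀ {p} → p ∈ᴸ P → proj₁ p ∉ edges (trace C′)
    P-edge∉C′ {p} p∈ e∈ with edge∈trace⁻ C′ e∈
    ... | d , d∈ , eq with ∈-++⁻ Q d∈
    ...   | inj₁ d∈Q = Q-edge∉H d∈Q (subst (_∈ edges H) eq (C⊆H {edge _} (edge∈trace (P⇒C p∈))))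
    ...   | inj₂ d∈R = P#R p∈ d∈R (cong src (edge-injective cycle₀ (∈-++⁺ˡ p∈) (∈-++⁺ʳ P d∈R) eq))

    interior∉C′ : ∀ {p} → p ∈ᴸ p₂ ∷ Ps → src p ∉ verts (trace C′)
    interior∉C′ {p} p∈ s∈ with New.vertex-src s∈
    ... | d , d∈ , eq with ∈-++⁻ Q d∈
    ...   | inj₁ d∈Q = avoid p∈ (subst (_∈ verts (trace Q)) (sym eq) (src∈trace d∈Q))
    ...   | inj₂ d∈R = P#R (there p∈) d∈R eq

    H′-edge-cases : ∀ d → proj₁ d ∈ edges H′ → proj₁ d ∈ edges H ⊎ (d ∈ᴸ Q ⊎ rev d ∈ᴸ Q)
    H′-edge-cases d e∈ = Sum.map₂ (trace-edge-cases d Q) (∪-cases e∈)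

    C′⊆H′ : trace C′ ⊆ᶜ H′
    C′⊆H′ {vert x} x∈ with New.vertex-src x∈
    ... | d , d∈ , refl with ∈-++⁻ Q d∈
    ...   | inj₁ d∈Q = ∪ᶜ-right H {trace Q} {vert _} (src∈trace d∈Q)
    ...   | inj₂ d∈R = ∪ᶜ-left {H} {trace Q} {vert _} (R-src∈H d∈R)
    C′⊆H′ {edge e} e∈ with edge∈trace⁻ C′ e∈
    ... | d , d∈ , refl with ∈-++⁻ Q d∈
    ...   | inj₁ d∈Q = ∪ᶜ-right H {trace Q} {edge _} (edge∈trace d∈Q)
    ...   | inj₂ d∈R = ∪ᶜ-left {H} {trace Q} {edge _} (C⊆H {edge _} (edge∈trace (R⇒C d∈R)))

    rev-tgt≡ : ∀ {a d} → a ∈ᴸ C′ → rev d ∈ᴸ C′ → src d ≡ tgt a → rev d ≡ a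
    rev-tgt≡ {d = d} a∈ rd∈ eq = New.tgt-injective rd∈ a∈ (trans (tgt-rev d) eq)

    -- The path Q leaves u and enters v on the inner side of C, because it runs in K.
    insert : ∀ {a b q} → a ∈ᴸ C → b ∈ᴸ C → tgt a ≡ src b →
             (q ∈ᴸ Q ⊎ rev q ∈ᴸ Q) → src q ≡ src b →
             (∀ d → src d ≡ src b → d ∈ᴸ Q ⊎ rev d ∈ᴸ Q → d ≡ q) →
             Sweep H′ (rev a) q × Sweep H′ q b
    insert {q = q} a∈ b∈ a→b q∈ sq only =
      sweep-insert (corner-darts cycle a∈ b∈ a→b) a→b (edge∈trace a∈) (wedge a∈ b∈ a→b) sq
        (q∉H ∘ C⊆H {edge _}) (∪ᶜ-right H {trace Q} {edge _} q∈traceQ)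
        (outer b∈ q∈K (q∉H ∘ C⊆H {edge _}))
        (λ d sd e∈ → Sum.map₂ (only d sd) (H′-edge-cases d e∈))
      where
      q∉H : proj₁ q ∉ edges H
      q∉H = [ Q-edge∉H , Q-edge∉H ]′ q∈
      q∈traceQ : proj₁ q ∈ edges (trace Q)
      q∈traceQ = [ edge∈trace , edge∈trace {rev q} ]′ q∈
      q∈K : proj₁ q ∈ edges K
      q∈K = [ walk-edge walkQ , walk-edge walkQ ]′ q∈

    -- `Q` splits the old corner at `u`: the first sweep is the new inner corner of `C′`, the second
    -- the corner of the face between `P` and `Q`.
    sweeps-at-u : ∃[ r ] r ∈ᴸ R × tgt r ≡ u × Sweep H′ (rev r) q₁ × Sweep H′ q₁ p₁
    sweeps-at-u with walk-last walkR
    ... | r , r∈ , r→u = r , r∈ , r→u ,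
      insert (R⇒C r∈) (P⇒C (here refl)) (trans r→u u≡p₁) (inj₁ (here refl)) (trans (sym u≡q₁) u≡p₁) only
      where
      only : ∀ d → src d ≡ src p₁ → d ∈ᴸ Q ⊎ rev d ∈ᴸ Q → d ≡ q₁
      only d sd (inj₁ d∈) =
        New.src-injective (Q⇒C′ d∈) (here refl) (trans sd (trans (sym u≡p₁) u≡q₁))
      only d sd (inj₂ rd∈) = ⊥-elim (Q#R rd∈ r∈ (cong src
        (rev-tgt≡ (R⇒C′ r∈) (Q⇒C′ rd∈) (trans sd (trans (sym u≡p₁) (sym r→u))))))

    sweep-at-v : ∀ {a b} → a ∈ᴸ Q → b ∈ᴸ R → tgt a ≡ src b → Sweep H′ (rev a) b
    sweep-at-v {a} {b} a∈ b∈ a→b with walk-last walkP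
    ... | z , z∈ , z→v =
      proj₂ (insert (P⇒C z∈) (R⇒C b∈) (trans z→v (trans (sym a→v) a→b))
                    (inj₂ (subst (_∈ᴸ Q) (sym (rev-rev a)) a∈)) a→b only)
      where
      a→v : tgt a ≡ v
      a→v = Q-tgt∈H⇒v a∈ (subst (_∈ verts H) (sym a→b) (R-src∈H b∈))
      only : ∀ d → src d ≡ src b → d ∈ᴸ Q ⊎ rev d ∈ᴸ Q → d ≡ rev a
      only d sd (inj₁ d∈)  = ⊥-elim (Q#R d∈ b∈ sd)
      only d sd (inj₂ rd∈) = trans (sym (rev-rev d))
        (cong rev (rev-tgt≡ (Q⇒C′ a∈) (Q⇒C′ rd∈) (trans sd (sym a→b))))

    sweeps-inside-Q : ∀ {a b} → a ∈ᴸ Q → b ∈ᴸ Qs → tgt a ≡ src b → Sweep H′ (rev a) b × Sweep H′ b (rev a)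
    sweeps-inside-Q {a} {b} a∈ b∈ a→b =
      corner-sweeps cycle′ (Q⇒C′ a∈) (Q⇒C′ (there b∈)) a→b only
      where
      only : ∀ d → src d ≡ src b → proj₁ d ∈ edges H′ → proj₁ d ∈ edges (trace C′)
      only d sd e∈ with H′-edge-cases d e∈
      ... | inj₁ e∈H        = ⊥-elim (Qs-src∉H b∈ (subst (_∈ verts H) sd (sub _ _ e∈H)))
      ... | inj₂ (inj₁ d∈)  = edge∈trace (Q⇒C′ d∈)
      ... | inj₂ (inj₂ rd∈) = edge∈trace {rev d} (Q⇒C′ rd∈)

    wedge′ : ∀ {a b} → a ∈ᴸ C′ → b ∈ᴸ C′ → tgt a ≡ src b → Sweep H′ (rev a) b
    wedge′ {a} {b} a∈ b∈ a→b with ∈-++⁻ Q a∈ | ∈-++⁻ Q b∈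
    ... | _ | inj₁ (here refl) with sweeps-at-u
    ...   | r , r∈ , r→u , s , _ =
      subst (λ d → Sweep H′ (rev d) b)
        (New.tgt-injective (R⇒C′ r∈) a∈ (trans r→u (trans u≡q₁ (sym a→b)))) s
    wedge′ a∈ b∈ a→b | inj₁ a∈Q | inj₁ (there b∈Qs) = proj₁ (sweeps-inside-Q a∈Q b∈Qs a→b)
    wedge′ a∈ b∈ a→b | inj₂ a∈R | inj₁ (there b∈Qs) =
      ⊥-elim (Qs-src∉H b∈Qs (subst (_∈ verts H) a→b (R-tgt∈H a∈R)))
    wedge′ a∈ b∈ a→b | inj₁ a∈Q | inj₂ b∈R = sweep-at-v a∈Q b∈R a→b
    wedge′ {a} {b} a∈ b∈ a→b | inj₂ a∈R | inj₂ b∈R =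
      sweep-extend old (wedge (R⇒C a∈R) (R⇒C b∈R) a→b)
      where
      old : ∀ d → src d ≡ tgt a → proj₁ d ∈ edges H′ → proj₁ d ∈ edges H
      old d sd e∈ with H′-edge-cases d e∈
      ... | inj₁ e∈H        = e∈H
      ... | inj₂ (inj₁ d∈)  = ⊥-elim (Q#R d∈ b∈R (trans sd a→b))
      ... | inj₂ (inj₂ rd∈) = ⊥-elim (Q#R rd∈ a∈R (cong src (rev-tgt≡ a∈ (Q⇒C′ rd∈) sd)))

    -- The new face, between P and Q.
    F : Cell
    F = face (side p₁)

    F-along-P : ∀ {p} → p ∈ᴸ P → Joined H′ F (face (side p))
    F-along-P = walk-propagate (λ p → Joined H′ F (face (side p))) walkP pass ε
      where
      pass : ∀ {a b} → a ∈ᴸ P → b ∈ᴸ p₂ ∷ Ps → tgt a ≡ src b →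
             Joined H′ F (face (side a)) → Joined H′ F (face (side b))
      pass {a} {b} a∈ b∈ a→b j =
        j ◅◅ wedge-joined (sweep-extend old (wedge (P⇒C a∈) (P⇒C (there b∈)) a→b))
        where
        old : ∀ d → src d ≡ tgt a → proj₁ d ∈ edges H′ → proj₁ d ∈ edges H
        old d sd e∈ with H′-edge-cases d e∈
        ... | inj₁ e∈H        = e∈H
        ... | inj₂ (inj₁ d∈)  =
          ⊥-elim (avoid b∈ (subst (_∈ verts (trace Q)) (trans sd a→b) (src∈trace d∈)))
        ... | inj₂ (inj₂ rd∈) =
          ⊥-elim (avoid b∈ (subst (_∈ verts (trace Q)) (trans (tgt-rev d) (trans sd a→b)) (tgt∈trace rd∈)))

    -- Interior vertices of `Q` carry no edge of `H`, so there the sweep on the outer side of `C′`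
    -- exists as well as the one on the inner side. The corner at `u` connects these outer sides
    -- with `F`.
    F-along-Q : ∀ {q} → q ∈ᴸ Q → Joined H′ F (face (side (rev q)))
    F-along-Q = walk-propagate (λ q → Joined H′ F (face (side (rev q)))) walkQ
      (λ a∈ b∈ a→b j → j ◅◅ joined-sym (sweep-joined (proj₂ (sweeps-inside-Q a∈ b∈ a→b))))
      (let _ , _ , _ , _ , s = sweeps-at-u in joined-sym (sweep-joined s))

    interior-joined : ∀ {p} → p ∈ᴸ p₂ ∷ Ps → Joined (trace C′) (vert (src p)) F
    interior-joined p∈ = joined-≺ (vert≺side _) (interior∉C′ p∈) id
      ◅◅ joined-sym (joined-mono (λ {c} → C′⊆H′ {c}) (F-along-P (there p∈)))

    P-edge-joined : ∀ {p} → p ∈ᴸ P → Joined (trace C′) (edge (proj₁ p)) F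
    P-edge-joined p∈ = joined-≺ (edge≺side _) (P-edge∉C′ p∈) id
      ◅◅ joined-sym (joined-mono (λ {c} → C′⊆H′ {c}) (F-along-P p∈))

    K′⊆K : K′ ⊆ᶜ K
    K′⊆K {c} c∈ = proj₁ (Equivalence.to (bounded c) c∈)

    -- All interior vertices of `P` lie in the component of `F` off `C′`, so it is exactly this
    -- component that `BoundedBy` removes from `K`; `∈K′` is the converse.
    K′-not-joined : ∀ {c} → c ∈ᶜ K′ → ¬ Joined (trace C′) F c
    K′-not-joined {c} c∈ j = proj₂ (Equivalence.to (bounded c) c∈) (src p₂) (here refl)
      (interior-joined (here refl) ◅◅ j)

    ∈K′ : ∀ {c} → c ∈ᶜ K → ¬ Joined (trace C′) F c → c ∈ᶜ K′
    ∈K′ {c} c∈ not-joined = Equivalence.from (bounded c) (c∈ , λ w w∈ j → case ∈-map⁻ src w∈ of λ where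
      (p , p∈ , refl) → not-joined (joined-sym (interior-joined p∈) ◅◅ j))

    C-cases : ∀ {c} → c ∈ᶜ trace C → c ∈ᶜ trace C′ ⊎ Joined (trace C′) F c
    C-cases {vert x} x∈ with CycleLemmas.vertex-src cycle x∈
    ... | d , d∈ , refl with C⇒P⊎R d∈
    ...   | inj₁ (here refl) = inj₁ (subst (_∈ verts (trace C′)) (trans (sym u≡q₁) u≡p₁) (src∈trace {ds = C′} (here refl)))
    ...   | inj₁ (there p∈)  = inj₂ (joined-sym (interior-joined p∈))
    ...   | inj₂ r∈          = inj₁ (src∈trace (R⇒C′ r∈))
    C-cases {edge e} e∈ with edge∈trace⁻ C e∈
    ... | d , d∈ , refl with C⇒P⊎R d∈
    ...   | inj₁ p∈ = inj₂ (joined-sym (P-edge-joined p∈))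
    ...   | inj₂ r∈ = inj₁ (edge∈trace (R⇒C′ r∈))

    C′⊆K : trace C′ ⊆ᶜ K
    C′⊆K {c} = cellwise (trace⊆ (walk-++ walkQ walkR)) {c}

    C′⊆K′ : trace C′ ⊆ᶜ K′
    C′⊆K′ {c} c∈ = ∈K′ {c} (C′⊆K {c} c∈) (λ j → face-joined∉ c j c∈)

    state′ : State H′ C′ K′
    state′ = record
      { cycle = (u , walk-restrict (walk-++ walkQ walkR)
                       (C′⊆K′ {vert u} (subst (_∈ verts (trace C′)) (sym u≡q₁) (src∈trace {ds = C′} (here refl))))
                       (λ d∈ → C′⊆K′ {edge _} (edge∈trace d∈) , C′⊆K′ {vert _} (tgt∈trace d∈)))
              , proj₂ cycle′
      ; sub = λ e b e∈ → [ (λ e∈H → x∈p∪q⁺ (inj₁ (sub e b e∈H)))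
                         , (λ e∈Q → x∈p∪q⁺ {p = verts H} (inj₂ (trace-isSubgraph Q e b e∈Q))) ]′ (∪-cases e∈)
      ; incident = λ x∈ → [ (λ x∈H → let d , s , e∈ = incident x∈H in d , s , x∈p∪q⁺ (inj₁ e∈))
                          , (λ x∈Q → let d , s , e∈ = trace-incident Q x∈Q
                                     in d , s , x∈p∪q⁺ {p = edges H} (inj₂ e∈)) ]′ (∪-cases x∈)
      ; C⊆H = λ {c} → C′⊆H′ {c}
      ; H∩K⊆C = λ {c} → meet {c}
      ; wedge = wedge′
      ; outer = outer′
      }
      where
      meet : ∀ {c} → c ∈ᶜ H′ → c ∈ᶜ K′ → c ∈ᶜ trace C′
      meet {c} c∈H′ c∈K′ with ∪ᶜ-cases {H} {trace Q} c c∈H′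
      ... | inj₂ c∈Q = Q⊆C′ c c∈Q
        where
        Q⊆C′ : ∀ c → c ∈ᶜ trace Q → c ∈ᶜ trace C′
        Q⊆C′ (vert x) x∈ with vert∈trace⁻ Q x∈
        ... | d , d∈ , inj₁ refl = src∈trace (Q⇒C′ d∈)
        ... | d , d∈ , inj₂ refl = tgt∈trace (Q⇒C′ d∈)
        Q⊆C′ (edge e) e∈ with edge∈trace⁻ Q e∈
        ... | d , d∈ , refl = edge∈trace (Q⇒C′ d∈)
      ... | inj₁ c∈H with C-cases {c} (H∩K⊆C {c} c∈H (K′⊆K {c} c∈K′))
      ...   | inj₁ c∈C′ = c∈C′
      ...   | inj₂ j    = ⊥-elim (K′-not-joined {c} c∈K′ j)
      outer′ : ∀ {d c} → d ∈ᴸ C′ → c ∈ᶜ K′ → ¬ c ∈ᶜ trace C′ → ¬ Joined (trace C′) (face (side (rev d))) c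
      outer′ {d} {c} d∈ c∈ c∉ j with ∈-++⁻ Q d∈
      ... | inj₁ d∈Q = K′-not-joined {c} c∈ (joined-mono (λ {c} → C′⊆H′ {c}) (F-along-Q d∈Q) ◅◅ j)
      ... | inj₂ d∈R = outer (R⇒C d∈R) (K′⊆K {c} c∈) (off-C c j) (joined-avoid j off-C)
        where
        -- A cell of `C` in this component is off `C′`, hence joined to `F` by `C-cases`; then `c`
        -- would be joined to `F` too.
        off-C : ∀ x → Joined (trace C′) (face (side (rev d))) x → ¬ x ∈ᶜ trace C
        off-C x j′ x∈ with C-cases {x} x∈
        ... | inj₁ x∈C′ = face-joined∉ x j′ x∈C′
        ... | inj₂ F~x  = K′-not-joined {c} c∈ (F~x ◅◅ joined-sym j′ ◅◅ j)

    -- A cell of `K′` in the face `F` of `H′` would be joined to `F` off the smaller graph `C′` as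
    -- well. The intended `L` is the final graph.
    F-persists : ∀ {L g} → L ⊆ᶜ H′ ∪ᵖ K′ → Joined H′ F g → Joined L F g
    F-persists {L} L⊆ j = joined-avoid j off-L
      where
      off-L : ∀ c → Joined H′ F c → ¬ c ∈ᶜ L
      off-L c j c∈ with ∪ᶜ-cases {H′} {K′} c (L⊆ {c} c∈)
      ... | inj₁ c∈H′ = face-joined∉ c j c∈H′
      ... | inj₂ c∈K′ = K′-not-joined {c} c∈K′ (joined-mono (λ {c} → C′⊆H′ {c}) j)

  -- The indices are patterns: at least two darts in `P` and at least one in `Q` and in `R`, as
  -- `Cut` requires.
  data Shortcut (K : Part) (u v : Vertex) : List Dart → List Dart → List Dart → Set where
    shortcut : ∀ {p₁ p₂ Ps q₁ Qs r₁ Rs} →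
               Walk K u (p₁ ∷ p₂ ∷ Ps) v → Walk K u (q₁ ∷ Qs) v → Walk K v (r₁ ∷ Rs) u →
               (∀ {p} → p ∈ᴸ p₂ ∷ Ps → src p ∉ verts (trace (q₁ ∷ Qs))) →
               length (q₁ ∷ Qs) < length (p₁ ∷ p₂ ∷ Ps) →
               Shortcut K u v (p₁ ∷ p₂ ∷ Ps) (q₁ ∷ Qs) (r₁ ∷ Rs)

  -- Since `R` is not empty, `P` is a path with different ends. Not being shortest then means being
  -- longer than `Q`, and `Q` has a dart, so `P` has two.
  find-shortcut : ∀ {K C u v P Q R} → Cycle K C → Subpath C u P v R → ¬ ShortestPath K u P v →
    (∀ {u′ v′ P′ R′} → Subpath C u′ P′ v′ R′ → ¬ ShortestPath K u′ P′ v′ → length P ≤ length P′) →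
    ShortestPath K u Q v → Shortcut K u v P Q R
  find-shortcut {R = []} cyc (_ , _ , R≢[]) long minimal sp = ⊥-elim (R≢[] refl)
  find-shortcut {K} {P = []} cyc (_ , nil u∈ , _) long minimal sp = ⊥-elim (long
    ((nil u∈K , [] ∷ []) , ([] , nil u∈K , refl) , λ _ _ → z≤n))
    where u∈K = proj₁ (CycleLemmas.cycle⊆ cyc) u∈
  find-shortcut {K} {C} {u} {v} {p₁ ∷ P₀} {Q} {r₁ ∷ Rs} cyc (rot , walk , _) long minimal ((walkQ , _) , _ , shortest)
    with rotate-cycle rot cyc
  ... | (w , closed) , uniq , _ with walk-split (p₁ ∷ P₀) closed
  ...   | x , walkP , walkR with refl ← trans (walk-head walk) (sym (walk-head walkP))
    with refl ← walk-target walk walkP =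
    build P₀ Q refl refl walkQ
    where
    P = p₁ ∷ P₀
    R = r₁ ∷ Rs

    uniq-P : Unique (u ∷ map tgt P)
    uniq-P = subst Unique (walk-srcs walkP) (unique-prefix (map src P ++ [ v ]) (subst Unique eq uniq))
      where
      eq : map src (P ++ R) ≡ (map src P ++ [ v ]) ++ map src Rs
      eq = trans (map-++ src P R) (trans (cong (λ y → map src P ++ y ∷ map src Rs) (sym (walk-head walkR)))
                                         (sym (++-assoc (map src P) [ v ] (map src Rs))))

    Q<P : length Q < length P
    Q<P = ℕ.≰⇒> λ P≤Q → long ((walkP , uniq-P) , (P , walkP , refl) , λ ds w → ℕ.≤-trans P≤Q (shortest ds w))

    u≢v : u ≢ v
    u≢v u≡v = All.lookup (AllPairs.head uniq) (∈-map⁺ src (∈-++⁺ʳ P₀ (here refl)))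
                      (trans (sym (walk-head walkP)) (trans u≡v (walk-head walkR)))

    -- A common vertex of Q and the interior of P would split both, and one
    -- of the two parts of P would be a shorter non-geodesic subpath.
    avoid : ∀ {p} → p ∈ᴸ P₀ → src p ∉ verts (trace Q)
    avoid p∈ s∈ with walk-split-at walkQ s∈ | ∈-∃++ p∈
    avoid {p} p∈ s∈ | Q₁ , Q₂ , refl , walkQ₁ , walkQ₂ | Y , Z , refl with walk-split (p₁ ∷ Y) walk
    ... | _ , walkP₁ , walkP₂ with refl ← walk-head walkP₂ = ℕ.<⇒≱ lengths Q≥
      where
      P₁ = p₁ ∷ Y
      P₂ = p ∷ Z
      rot′ : Rotation C (P₁ ++ (P₂ ++ R))
      rot′ = subst (Rotation C) (++-assoc P₁ P₂ R) rot
      size : length P ≡ length P₁ + length P₂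
      size = length-++ P₁
      lengths : length Q₁ + length Q₂ < length P₁ + length P₂
      lengths = subst₂ _<_ (length-++ Q₁) size Q<P
      P₁≤Q₁ : length P₁ ≤ length Q₁
      P₁≤Q₁ = ℕ.≮⇒≥ λ Q₁<P₁ → ℕ.<⇒≱ (ℕ.m<m+n (length P₁) (s≤s z≤n)) (subst (_≤ length P₁) size
        (minimal (rot′ , walkP₁ , λ ()) λ (_ , _ , least) → ℕ.<⇒≱ Q₁<P₁ (least Q₁ walkQ₁)))
      P₂≤Q₂ : length P₂ ≤ length Q₂
      P₂≤Q₂ = ℕ.≮⇒≥ λ Q₂<P₂ → ℕ.<⇒≱ (ℕ.m<n+m (length P₂) {length P₁} (s≤s z≤n)) (subst (_≤ length P₂) size
        (minimal (subst (Rotation C) (++-assoc P₂ R P₁) (rotation-step P₁ rot′) , walkP₂ , λ ())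
                 λ (_ , _ , least) → ℕ.<⇒≱ Q₂<P₂ (least Q₂ walkQ₂)))
      Q≥ : length P₁ + length P₂ ≤ length Q₁ + length Q₂
      Q≥ = ℕ.+-mono-≤ P₁≤Q₁ P₂≤Q₂

    build : ∀ P′ Q′ → P′ ≡ P₀ → Q′ ≡ Q → Walk K u Q′ v → Shortcut K u v (p₁ ∷ P′) Q′ R
    build _          []      _    _    (nil _) = ⊥-elim (u≢v refl)
    build []         (_ ∷ _) refl refl _       with Q<P
    ... | s≤s ()
    build (p₂ ∷ Ps) (q₁ ∷ Qs) refl refl _ = shortcut walkP walkQ walkR avoid Q<P

  greedy-grows : ∀ {D H C K L} → Greedy D H C K L → H ⊆ᶜ L
  greedy-grows (stop _) {c} = ∪ᶜ-left {c = c}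
  greedy-grows (cut {Q = Q} _ _ _ _ _ _ _ g) {c} c∈ = greedy-grows g {c} (∪ᶜ-left {L = trace Q} {c} c∈)

  greedy⊆ : ∀ {D H C K L} → State H C K → Greedy D H C K L → L ⊆ᶜ H ∪ᵖ K
  greedy⊆ {H = H} {C} {K} st (stop _) {c} c∈ = ∪ᶜ-left {H} {K} {c}
    ([ id , State.C⊆H st {c} ]′ (∪ᶜ-cases {H} {trace C} c c∈))
  greedy⊆ {H = H} {K = K} st (cut {Q = Q} {R} {K′} _ sp long minimal shortest cyc′ bnd g) {c} c∈
    with find-shortcut (State.cycle st) sp long minimal shortest
  ... | shortcut walkP walkQ walkR avoid _
    with ∪ᶜ-cases {H ∪ᵖ trace Q} {K′} c
           (greedy⊆ (Cut.state′ st (proj₁ sp) walkP walkQ walkR avoid cyc′ bnd) g {c} c∈)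
  ...   | inj₂ c∈K′ = ∪ᶜ-right H {K} {c} (proj₁ (Equivalence.to (bnd c) c∈K′))
  ...   | inj₁ c∈H′ with ∪ᶜ-cases {H} {trace Q} c c∈H′
  ...     | inj₁ c∈H = ∪ᶜ-left {H} {K} {c} c∈H
  ...     | inj₂ c∈Q = ∪ᶜ-right H {K} {c} (cellwise (trace⊆ walkQ) {c} c∈Q)

  sides-joined : ∀ {H C K} → State H C K → ∀ {c d} → c ∈ᴸ C → d ∈ᴸ C → Joined H (face (side c)) (face (side d))
  sides-joined {H} st {c} c∈ = cycle-propagate (λ d → Joined H (face (side c)) (face (side d))) (State.cycle st)
    (λ a∈ b∈ a→b j → j ◅◅ wedge-joined (State.wedge st a∈ b∈ a→b)) c∈ ε

  -- Counting faces by boundary edges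

  module Counting (L : Part) (same-face? : ∀ f g → Dec (SameFace L f g)) where

    -- A set of faces of `L` is encoded as a predicate on the faces of `G` that respects
    -- `SameFace L`.
    Closed : (Fin nF → Set) → Set
    Closed A = ∀ {f g} → SameFace L f g → A f → A g

    IsBoundary : (Fin nF → Set) → Edge → Set
    IsBoundary A e = e ∈ edges L × (Leaves true ⊎ Leaves false)
      where
      Leaves : Bool → Set
      Leaves b = A (side (e , b)) × ¬ A (side (rev (e , b)))

    module _ {A : Fin nF → Set} (A? : ∀ f → Dec (A f)) where

      isBoundary? : ∀ e → Dec (IsBoundary A e)
      isBoundary? e = (e ∈? edges L) ×-dec
        ((A? _ ×-dec ¬? (A? _)) ⊎-dec (A? _ ×-dec ¬? (A? _)))

      ∂ : Subset nE
      ∂ = satisfying isBoundary?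

      ∂⁺ : ∀ d → proj₁ d ∈ edges L → A (side d) → ¬ A (side (rev d)) → proj₁ d ∈ ∂
      ∂⁺ (e , true)  e∈ a na = ∈-satisfying⁺ isBoundary? (e∈ , inj₁ (a , na))
      ∂⁺ (e , false) e∈ a na = ∈-satisfying⁺ isBoundary? (e∈ , inj₂ (a , na))

      ∂⁻ : ∀ {e} → e ∈ ∂ → ∃[ b ] e ∈ edges L × A (side (e , b)) × ¬ A (side (rev (e , b)))
      ∂⁻ e∈ with ∈-satisfying⁻ isBoundary? e∈
      ... | e∈L , inj₁ (a , na) = true  , e∈L , a , na
      ... | e∈L , inj₂ (a , na) = false , e∈L , a , na

    AtMost : ℕ → (Fin nF → Set) → Set
    AtMost n A = ∀ m (F : Fin m → Fin nF) → Injective _≡_ (SameFace L) F → (∀ i → A (F i)) → m ≤ n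

    atMost-suc : ∀ {n A} f → AtMost n (λ g → A g × ¬ SameFace L f g) → AtMost (suc n) A
    atMost-suc f few m F inj F∈A with any? (λ i → same-face? f (F i))
    ... | no none = ℕ.m≤n⇒m≤1+n (few m F inj λ i → F∈A i , λ s → none (i , s))
    atMost-suc f few (suc m) F inj F∈A | yes (i , f~i) = s≤s (few m (F ∘ punchIn i)
      (punchIn-injective i _ _ ∘ inj)
      λ j → F∈A _ , λ f~j → punchInᵢ≢i i j (inj (joined-sym f~j ◅◅ f~i)))

    -- When the new face F belongs to A, the path P lies in ∂ A, and removing F
    -- from A trades P for the shorter Q.
    atMost-∂ : ∀ {D H C K M} → M ≡ L → State H C K → Greedy D H C K M →
      ∀ {A} (A? : ∀ f → Dec (A f)) → Closed A →
      (∀ d → proj₁ d ∈ edges H → A (side d) → d ∈ᴸ C) → AtMost ∣ ∂ A? ∣ A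
    atMost-∂ {H = H} {C} refl st (stop _) {A} A? closed inner = count
      where
      open State st
      L⊆H : L ⊆ᶜ H
      L⊆H {c} c∈ = [ id , C⊆H {c} ]′ (∪ᶜ-cases {H} {trace C} c c∈)
      representative : ∀ {f} → A f → ∃[ d ] d ∈ᴸ C × A (side d) × Joined H (face f) (face (side d))
      representative {f} a with cycle-dart cycle
      ... | h , h∈ with joined-to-subgraph sub incident {h} (C⊆H {edge _} (edge∈trace h∈)) f
      ...   | d , d∈ , j = d , inner d d∈ a′ , a′ , j
        where a′ = closed (joined-mono (λ {c} → L⊆H {c}) j) a
      -- Each face in `A` contains an inner side of `C`, and these sides form one face, so `A` has
      -- at most one. If it has one, the edge of `d` is in the boundary: a reverse side in `A` would
      -- put `rev d` on `C`.
      count : AtMost ∣ ∂ A? ∣ A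
      count zero F inj F∈A = z≤n
      count (suc zero) F inj F∈A with representative (F∈A zero)
      ... | d , d∈ , a , _ = unique⇒length≤ (∂ A?) ([] ∷ []) λ where
        (here refl) → ∂⁺ A? d (x∈p∪q⁺ (inj₁ (C⊆H {edge _} (edge∈trace d∈)))) a
                        (rev∉cycle cycle d∈ ∘ inner (rev d) (C⊆H {edge _} (edge∈trace d∈)))
      count (suc (suc m)) F inj F∈A with representative (F∈A zero) | representative (F∈A (suc zero))
      ... | d , d∈ , _ , j | d′ , d′∈ , _ , j′ =
        case inj (joined-mono (λ {c} → L⊆H {c}) (j ◅◅ sides-joined st d∈ d′∈ ◅◅ joined-sym j′)) of λ ()
    atMost-∂ {H = H} {C} refl st (cut {P = P} {Q} {R} {K′} _ sp long minimal shortest cyc′ bnd g) {A} A? closed inner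
      with find-shortcut (State.cycle st) sp long minimal shortest
    ... | shortcut {p₁ = p₁} walkP walkQ walkR avoid Q<P = count
      where
      open State st
      open Cut st (proj₁ sp) walkP walkQ walkR avoid cyc′ bnd hiding (P; Q; R)

      H′⊆L : H′ ⊆ᶜ L
      H′⊆L {c} = greedy-grows g {c}
      L⊆ : L ⊆ᶜ H′ ∪ᵖ K′
      L⊆ {c} = greedy⊆ state′ g {c}
      H⊆L : H ⊆ᶜ L
      H⊆L {c} c∈ = H′⊆L {c} (∪ᶜ-left {H} {trace Q} {c} c∈)

      P~F : ∀ {p} → p ∈ᴸ P → SameFace L (side p₁) (side p)
      P~F p∈ = F-persists (λ {c} → L⊆ {c}) (F-along-P p∈)
      Q~F : ∀ {q} → q ∈ᴸ Q → SameFace L (side p₁) (side (rev q))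
      Q~F q∈ = F-persists (λ {c} → L⊆ {c}) (F-along-Q q∈)

      -- The inner sides of `P` and the outer sides of `Q` belong to `F`; once `F` is removed, the
      -- hypothesis `inner` passes from `C` to `C′`.
      inner′ : ∀ d → proj₁ d ∈ edges H′ → A (side d) × ¬ SameFace L (side p₁) (side d) → d ∈ᴸ C′
      inner′ d e∈ (a , d≁F) with H′-edge-cases d e∈
      ... | inj₂ (inj₁ d∈Q)  = Q⇒C′ d∈Q
      ... | inj₂ (inj₂ rd∈Q) = ⊥-elim (d≁F (subst (SameFace L (side p₁) ∘ side) (rev-rev d) (Q~F rd∈Q)))
      ... | inj₁ e∈H with C⇒P⊎R (inner d e∈H a)
      ...   | inj₁ d∈P = ⊥-elim (d≁F (P~F d∈P))
      ...   | inj₂ d∈R = R⇒C′ d∈R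

      one-sided : ∀ d → proj₁ d ∈ edges H → A (side d) → ¬ A (side (rev d))
      one-sided d e∈ a a′ = rev∉cycle cycle (inner d e∈ a) (inner (rev d) e∈ a′)

      A′ : Fin nF → Set
      A′ f = A f × ¬ SameFace L (side p₁) f
      A′? : ∀ f → Dec (A′ f)
      A′? f = A? f ×-dec ¬? (same-face? (side p₁) f)

      ∂A′⊆ : ∂ A′? ⊆ (∂ A? ─ edges (trace P)) ∪ edges (trace Q)
      ∂A′⊆ {e} e∈∂ with ∂⁻ A′? e∈∂ | e ∈? edges (trace Q)
      ... | _ | yes e∈Q = x∈p∪q⁺ {p = ∂ A? ─ edges (trace P)} (inj₂ e∈Q)
      ... | b , e∈L , (a , d≁F) , outside′ | no e∉Q =
        x∈p∪q⁺ (inj₁ (x∈p∧x∉q⇒x∈p─q (∂⁺ A? d e∈L a other∉A) e∉P))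
        where
        d = e , b
        -- A far side in `A` but not in `A′` would be `F`. Then `e` cannot be in `H`, whose edges
        -- have at most one side in `A`, nor in `Q` by assumption, nor in `K′`, none of whose cells
        -- is joined to `F`.
        other∉A : ¬ A (side (rev d))
        other∉A a′ = outside′ (a′ , λ F~ → case ∪-cases {p = edges H′} (L⊆ {edge e} e∈L) of λ where
            (inj₁ e∈H′) → in-H′ e∈H′
            (inj₂ e∈K′) → in-K′ F~ e∈K′)
          where
          in-H′ : ¬ e ∈ edges H′
          in-H′ e∈H′ = [ (λ e∈H → one-sided d e∈H a a′) , e∉Q ]′ (∪-cases e∈H′)
          in-K′ : SameFace L (side p₁) (side (rev d)) → ¬ e ∈ edges K′
          in-K′ F~ e∈K′ = K′-not-joined {edge e} e∈K′
            (joined-mono (λ {c} → H′⊆L {c} ∘ C′⊆H′ {c}) F~ ◅◅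
             joined-sym (joined-≺ (edge≺side (rev d)) (in-H′ ∘ C′⊆H′ {edge e}) id))
        e∉P : e ∉ edges (trace P)
        e∉P e∈P with edge∈trace⁻ P e∈P
        ... | p , p∈ , eq with same-edge d p eq
        ...   | inj₁ refl = d≁F (P~F p∈)
        ...   | inj₂ refl = rev∉cycle cycle (P⇒C p∈) (inner (rev p) (C⊆H {edge _} (edge∈trace (P⇒C p∈))) a)

      count : AtMost ∣ ∂ A? ∣ A
      count with A? (side p₁)
      -- Without `F` in `A`, the same set and the same boundary go to the next iteration.
      ... | no  F∉A = atMost-∂ refl state′ g A? closed
                        λ d e∈ a → inner′ d e∈ (a , λ F~ → F∉A (closed (joined-sym F~) a))
      ... | yes F∈A = λ m F inj F∈ → ℕ.≤-trans (atMost-suc {A = A} (side p₁) fewer m F inj F∈) sizes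
        where
        fewer : AtMost ∣ ∂ A′? ∣ A′
        fewer = atMost-∂ refl state′ g A′?
          (λ f~g (a , F≁f) → closed f~g a , λ F~g → F≁f (F~g ◅◅ joined-sym f~g)) inner′
        P⊆∂ : edges (trace P) ⊆ ∂ A?
        P⊆∂ e∈ with edge∈trace⁻ P e∈
        ... | p , p∈ , refl = ∂⁺ A? p (H⊆L {edge _} p∈H) (closed (P~F p∈) F∈A)
                                (one-sided p p∈H (closed (P~F p∈) F∈A))
          where p∈H = C⊆H {edge _} (edge∈trace (P⇒C p∈))
        ∣P∣≥ : length P ≤ ∣ edges (trace P) ∣
        ∣P∣≥ = subst (_≤ ∣ edges (trace P) ∣) (length-map proj₁ P) (unique⇒length≤ (edges (trace P))
          (injective⇒unique-map (unique-prefix P (unique-map⁻ (proj₁ (proj₂ cycle₀))))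
            λ a∈ b∈ → edge-injective cycle₀ (∈-++⁺ˡ a∈) (∈-++⁺ˡ b∈))
          λ x∈ → case ∈-map⁻ proj₁ {xs = P} x∈ of λ where (p , p∈ , refl) → edge∈trace p∈)
        sizes : ∣ ∂ A′? ∣ < ∣ ∂ A? ∣
        sizes = exchange-size (∂ A?) _ _ ∂A′⊆ P⊆∂ (ℕ.≤-trans (s≤s (∣traceᵉ∣≤ Q)) (ℕ.≤-trans Q<P ∣P∣≥))

-- Faces interacting with a cycle

module Interactions (G : Graph) (S : SphereEmbedding G) where
  open PlaneNotions G S
  open Walks G
  open Cells G S
  open Orientation using (side)

  -- The cells in the closure of a face are its edges and their ends. All of these are in `K`, so no
  -- step of `Joined` leaves `f`.
  isolated-face : ∀ {K f c} → (∀ {e b} → faceOf (e , b) ≡ f → e ∈ edges K) → IsSubgraph K →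
                  Joined K (face f) c → c ≡ face f
  isolated-face around sub ε = refl
  isolated-face around sub (bwd (c≺f , c∉ , _) ◅ _) = ⊥-elim (c∉ (below c≺f refl around sub))
    where
    below : ∀ {K f g c} → c ≺ face g → g ≡ f → (∀ {e b} → faceOf (e , b) ≡ f → e ∈ edges K) →
            IsSubgraph K → c ∈ᶜ K
    below (edge-face e b)     eq around sub = around eq
    below (vert-face (e , b)) eq around sub = sub e b (around eq)

  module FaceCycle {C f₀} (fc : IsFaceCycle whole C f₀) where

    incident-edge : ∀ {e b} → faceOf (e , b) ≡ f₀ → e ∈ edges (trace C)
    incident-edge {e} {b} eq = Equivalence.from (proj₂ fc e)
      (∈⊤ , b , subst (SameFace whole (faceOf (e , b))) eq ε)

    C-incident : ∀ {d} → d ∈ᴸ C → ∃[ b ] faceOf (proj₁ d , b) ≡ f₀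
    C-incident {d} d∈ with Equivalence.to (proj₂ fc (proj₁ d)) (edge∈trace d∈)
    ... | _ , b , j with refl ← isolated-face {whole} (λ _ → ∈⊤) (λ _ _ _ → ∈⊤) j = b , refl

    isolated : ∀ {K c} → IsSubgraph K → trace C ⊆ᶜ K → Joined K (face f₀) c → c ≡ face f₀
    isolated sub C⊆K = isolated-face (λ eq → C⊆K {edge _} (incident-edge eq)) sub

    module _ (O : Orientation) where
      open Sweeping O hiding (side)
      open Procedure G S O

      -- The dart `rotate (rev a)` has side `f₀` like `a`, so its edge is on `C` and it is `b` or
      -- `rev a`. In the latter case `rotate` fixes `rev a`, making it the only dart at its vertex,
      -- although `b` leaves there too.
      face-along-C : ∀ {c} → c ∈ᴸ C → side O c ≡ f₀ → (∀ d → side O d ≡ f₀ → proj₁ d ∈ edges (trace C)) →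
                     ∀ {d} → d ∈ᴸ C → side O d ≡ f₀
      face-along-C c∈ eq around = cycle-propagate (λ d → side O d ≡ f₀) (proj₁ fc) pass c∈ eq
        where
        pass : ∀ {a b} → a ∈ᴸ C → b ∈ᴸ C → tgt a ≡ src b → side O a ≡ f₀ → side O b ≡ f₀
        pass {a} {b} a∈ b∈ a→b a-f₀ with corner-darts (proj₁ fc) a∈ b∈ a→b r (trans (rotate-src (rev a)) a→b) (around r r-f₀)
          where
          r = rotate (rev a)
          r-f₀ : side O r ≡ f₀
          r-f₀ = trans (side-rotate (rev a)) (trans (cong (side O) (rev-rev a)) a-f₀)
        ... | inj₁ r≡b = trans (cong (side O) (sym r≡b))
                           (trans (side-rotate (rev a)) (trans (cong (side O) (rev-rev a)) a-f₀))
        ... | inj₂ r≡ra = ⊥-elim (rev∉cycle (proj₁ fc) a∈ (subst (_∈ᴸ C) b≡ra b∈))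
          where
          b≡ra : b ≡ rev a
          b≡ra = rotate-induction (_≡ rev a) refl (λ { _ refl → r≡ra }) b (sym a→b)

      start : (∀ {d} → d ∈ᴸ C → side O (rev d) ≡ f₀) → ∀ {G′} → Cycle G′ C → State (trace C) C G′
      start outside-f₀ cyc = record
        { cycle    = cyc
        ; sub      = trace-isSubgraph C
        ; incident = trace-incident C
        ; C⊆H      = id
        ; H∩K⊆C    = λ c∈ _ → c∈
        ; wedge    = λ a∈ b∈ a→b → proj₁ (corner-sweeps cyc a∈ b∈ a→b λ _ _ e∈ → e∈)
        -- The outer side is `f₀`, which is alone in its component, and a face is never a cell of a
        -- `Part`.
        ; outer    = λ { {d} {c} d∈ c∈ _ j → subst (_∈ᶜ _)
                       (isolated (trace-isSubgraph C) (λ {c} → id)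
                         (subst (λ f → Joined (trace C) (face f) c) (outside-f₀ d∈) j)) c∈ }
        }

    -- Some dart of `C` has `f₀` on one side, and `face-along-C` carries this around `C`. The
    -- orientation returned is the mirror image of the one used there, since `f₀` is to lie beside
    -- the reversed darts.
    orientation : ∃[ O ] ∀ {d} → d ∈ᴸ C → side O (rev d) ≡ f₀
    orientation with cycle-dart (proj₁ fc)
    ... | c , c∈ with C-incident c∈
    ...   | b , eq with same-edge (proj₁ c , b) c refl
    ...     | inj₁ refl = negative , λ {d} d∈ → trans (cong faceOf (rev-rev d))
                (face-along-C positive c∈ eq (λ d → incident-edge) d∈)
    ...     | inj₂ refl = positive , face-along-C negative c∈ eq (λ d → incident-edge)

    -- The reverses of the darts of `C` have side `f₀`, so excluding `f₀` from `A` gives the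
    -- hypothesis of `atMost-∂` at the start. Boundary edges are described by `≺`, which hides the
    -- choice of orientation.
    atMost : ∀ {D G′ H} → Cycle G′ C → GreedyFilling D G′ C H → (∀ f g → Dec (SameFace H f g)) →
      ∀ {A : Fin nF → Set} → (∀ f → Dec (A f)) → (∀ {f g} → SameFace H f g → A f → A g) → ¬ A f₀ →
      (B : Subset nE) →
      (∀ {e f g} → e ∈ edges H → edge e ≺ face f → edge e ≺ face g → A f → ¬ A g → e ∈ B) →
      ∀ m (F : Fin m → Fin nF) → Injective _≡_ (SameFace H) F → (∀ i → A (F i)) → m ≤ ∣ B ∣
    atMost {H = H} cyc greedy same-face? {A} A? closed f₀∉A B ∂⊆B m F inj F∈A with orientation
    ... | O , outside-f₀ = ℕ.≤-trans
      (atMost-∂ refl (start O outside-f₀ cyc) greedy A? closed inner m F inj F∈A)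
      (p⊆q⇒∣p∣≤∣q∣ {p = ∂ A?} {q = B} λ e∈ → let b , e∈H , a , na = ∂⁻ A? e∈ in
        ∂⊆B e∈H (Orientation.edge≺side O (_ , b)) (Orientation.edge≺side O (_ , not b)) a na)
      where
      open Procedure.Counting G S O H same-face?
      inner : ∀ d → proj₁ d ∈ edges (trace C) → A (side O d) → d ∈ᴸ C
      inner d e∈ a with trace-edge-cases d C e∈
      ... | inj₁ d∈  = d∈
      ... | inj₂ rd∈ = ⊥-elim (f₀∉A (subst A
                         (trans (cong (side O) (sym (rev-rev d))) (outside-f₀ rd∈)) a))

    module Enclosure {H} (sub : IsSubgraph H) (C⊆H : trace C ⊆ᶜ H)
                     (same-face? : ∀ f g → Dec (SameFace H f g)) (γ : List Dart) where

      Enclosed : Fin nF → Set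
      Enclosed f = FillingFace H f₀ f × Interacts H f₀ γ f

      enclosed-closed : ∀ {f g} → SameFace H f g → Enclosed f → Enclosed g
      enclosed-closed f~g (filling , inter) =
          (λ g~f₀ → filling (f~g ◅◅ g~f₀))
        , Sum.map (λ (c , c∈ , c~f) → c , c∈ , c~f ◅◅ f~g) (λ sep c c~g → sep c (c~g ◅◅ joined-sym f~g)) inter

      f₀-not-enclosed : ¬ Enclosed f₀
      f₀-not-enclosed (filling , _) = filling ε

      -- Across an edge not on γ, separation from C is passed on, unless γ meets the face.
      boundary-edge : ∀ {e f g} → edge e ≺ face f → edge e ≺ face g → Enclosed f → ¬ Enclosed g →
                      e ∈ edges (trace γ) ⊎ (∃[ c ] c ∈ᶜ trace γ × Joined H c (face f))
      boundary-edge {e} _ _ _ _ with e ∈? edges (trace γ)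
      boundary-edge _ _ _ _ | yes e∈ = inj₁ e∈
      boundary-edge _ _ (_ , inj₁ meets) _ | no _ = inj₂ meets
      boundary-edge {e} {f} {g} e≺f e≺g (_ , inj₂ sep) g∉ | no e∉ with same-face? g f₀
      -- Here `g` is `f₀` itself, and crossing `e` leads from `f` to it without meeting γ.
      ... | yes g~f₀ with refl ← isolated sub (λ {c} → C⊆H {c}) (joined-sym g~f₀) =
        ⊥-elim (sep (face f) ε (bwd (e≺f , e∉ , id) ◅ fwd (e≺g , e∉ , id) ◅ ε))
      -- If γ does not meet the filling face `g`, all of `g` is joined off γ to `f` across `e`, so γ
      -- separates `g` from `C` just as it separates `f`.
      ... | no filling = ⊥-elim (avoids (inj₂ λ c c~g c~f₀ → sep (face f) ε
          (f~g ◅◅ joined-avoid (joined-sym c~g) (λ x g~x x∈γ → avoids (inj₁ (x , x∈γ , joined-sym g~x))) ◅◅ c~f₀)))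
        where
        f~g : Joined (trace γ) (face f) (face g)
        f~g = bwd (e≺f , e∉ , id) ◅ fwd (e≺g , e∉ , id) ◅ ε
        avoids : ¬ Interacts H f₀ γ g
        avoids inter = g∉ (filling , inter)

      -- If γ meets the face in a vertex, the edges at this vertex are outside `H` too, since `H` is
      -- a subgraph; so an edge of γ runs in the face. This allows charging met faces to darts of γ.
      met-by-dart : ∀ {c f} → c ∈ᶜ trace γ → Joined H c (face f) →
                    ∃[ d ] d ∈ᴸ γ × SameFace H (faceOf d) f
      met-by-dart {c} {f} c∈ c~f with incident-dart c c∈ (face-joined∉ c (joined-sym c~f))
        where
        incident-dart : ∀ c → c ∈ᶜ trace γ → ¬ c ∈ᶜ H →
                        ∃[ d ] d ∈ᴸ γ × proj₁ d ∉ edges H × Joined H (edge (proj₁ d)) c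
        incident-dart (edge e) e∈ e∉ with edge∈trace⁻ γ e∈
        ... | d , d∈ , refl = d , d∈ , e∉ , ε
        incident-dart (vert x) x∈ x∉ with vert∈trace⁻ γ x∈
        ... | d@(e , b) , d∈ , inj₁ refl =
          d , d∈ , x∉ ∘ sub e b , joined-sym (joined-≺ (vert-edge e b) x∉ (x∉ ∘ sub e b))
        ... | d@(e , b) , d∈ , inj₂ refl =
          d , d∈ , x∉ ∘ sub e (not b) , joined-sym (joined-≺ (vert-edge e (not b)) x∉ (x∉ ∘ sub e (not b)))
      ... | d@(e , b) , d∈ , d∉ , d~c =
        d , d∈ , joined-sym (joined-≺ (edge-face e b) d∉ id) ◅◅ d~c ◅◅ c~f

      on-boundary : ∀ {e f g} → e ∈ edges H → edge e ≺ face f → SameFace H g f → OnBoundary H g e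
      on-boundary e∈ (edge-face e b) g~f = e∈ , b , joined-sym g~f

      onBoundary? : ∀ f e → Dec (OnBoundary H f e)
      onBoundary? f e = (e ∈? edges H) ×-dec map′ [ (true ,_) , (false ,_) ]′ to-sum
        (same-face? (faceOf (e , true)) f ⊎-dec same-face? (faceOf (e , false)) f)
        where
        to-sum : (∃[ b ] SameFace H (faceOf (e , b)) f) →
                 SameFace H (faceOf (e , true)) f ⊎ SameFace H (faceOf (e , false)) f
        to-sum (true  , j) = inj₁ j
        to-sum (false , j) = inj₂ j

      -- Empty at the face `C`, whose size `k` does not bound, so that the estimate by `k` holds for
      -- every `f`.
      faceBoundary : Fin nF → Subset nE
      faceBoundary f with same-face? f f₀
      ... | yes _ = Subset.⊥
      ... | no  _ = satisfying (onBoundary? f)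

      ∈-faceBoundary : ∀ {f e} → FillingFace H f₀ f → OnBoundary H f e → e ∈ faceBoundary f
      ∈-faceBoundary {f} filling on with same-face? f f₀
      ... | yes f~f₀ = ⊥-elim (filling f~f₀)
      ... | no _     = ∈-satisfying⁺ (onBoundary? f) on

      ∣faceBoundary∣≤ : ∀ {k} → (∀ f → FillingFace H f₀ f → SizeAtMost H f k) → ∀ f → ∣ faceBoundary f ∣ ≤ k
      ∣faceBoundary∣≤ sizes f with same-face? f f₀
      ... | yes _ = ℕ.≤-trans (ℕ.≤-reflexive (∣⊥∣≡0 nE)) z≤n
      ... | no ff = sizes f ff _ λ e → ∈-satisfying⁻ (onBoundary? f)

      -- The charge of k + 1 edges per dart of γ: its own edge, and the boundary of the face of `H`
      -- that contains `faceOf d`.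
      edges-near-γ : Subset nE
      edges-near-γ = ⋃ (map (λ d → ⁅ proj₁ d ⁆ ∪ faceBoundary (faceOf d)) γ)

      ∣edges-near-γ∣≤ : ∀ {k} → (∀ f → FillingFace H f₀ f → SizeAtMost H f k) →
                        ∣ edges-near-γ ∣ ≤ (k + 1) * length γ
      ∣edges-near-γ∣≤ {k} sizes = ∣⋃-map∣≤ _ each γ
        where
        each : ∀ d → ∣ ⁅ proj₁ d ⁆ ∪ faceBoundary (faceOf d) ∣ ≤ k + 1
        each d = ℕ.≤-trans (∣p∪q∣≤∣p∣+∣q∣ ⁅ proj₁ d ⁆ _) (subst₂ _≤_
          (cong (_+ ∣ faceBoundary (faceOf d) ∣) (sym (∣⁅x⁆∣≡1 (proj₁ d)))) (ℕ.+-comm 1 k)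
          (s≤s (∣faceBoundary∣≤ sizes (faceOf d))))

      ∈-edges-near-γ : ∀ {d e} → d ∈ᴸ γ → e ∈ ⁅ proj₁ d ⁆ ∪ faceBoundary (faceOf d) → e ∈ edges-near-γ
      ∈-edges-near-γ = go γ
        where
        go : ∀ ds {d e} → d ∈ᴸ ds → e ∈ ⁅ proj₁ d ⁆ ∪ faceBoundary (faceOf d) →
             e ∈ ⋃ (map (λ d → ⁅ proj₁ d ⁆ ∪ faceBoundary (faceOf d)) ds)
        go (d ∷ ds) (here refl) e∈ = x∈p∪q⁺ (inj₁ e∈)
        go (d ∷ ds) (there d∈)  e∈ = x∈p∪q⁺ {p = ⁅ proj₁ d ⁆ ∪ faceBoundary (faceOf d)} (inj₂ (go ds d∈ e∈))

      boundary-near-γ : ∀ {e f g} → e ∈ edges H → edge e ≺ face f → edge e ≺ face g →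
                        Enclosed f → ¬ Enclosed g → e ∈ edges-near-γ
      boundary-near-γ e∈ e≺f e≺g f-enc g∉ with boundary-edge e≺f e≺g f-enc g∉
      ... | inj₁ e∈γ with edge∈trace⁻ γ e∈γ
      ...   | d , d∈ , refl = ∈-edges-near-γ d∈ (x∈p∪q⁺ (inj₁ (x∈⁅x⁆ _)))
      boundary-near-γ e∈ e≺f e≺g f-enc g∉ | inj₂ (c , c∈ , c~f) with met-by-dart {c} c∈ c~f
      ... | d , d∈ , d~f = ∈-edges-near-γ d∈ (x∈p∪q⁺ {p = ⁅ proj₁ d ⁆} (inj₂
        (∈-faceBoundary (λ d~f₀ → proj₁ f-enc (joined-sym d~f ◅◅ d~f₀)) (on-boundary e∈ e≺f d~f))))

      boundary-on-γ : trace γ ⊆ᵖ H → ∀ {e f g} → edge e ≺ face f → edge e ≺ face g →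
                      Enclosed f → ¬ Enclosed g → e ∈ edges (trace γ)
      boundary-on-γ γ⊆H e≺f e≺g f-enc g∉ with boundary-edge e≺f e≺g f-enc g∉
      ... | inj₁ e∈γ            = e∈γ
      ... | inj₂ (c , c∈ , c~f) = ⊥-elim (face-joined∉ c (joined-sym c~f) (cellwise γ⊆H {c} c∈))

      enclosed-atMost : ∀ {D G′} → Cycle G′ C → GreedyFilling D G′ C H → (∀ f → Dec (Enclosed f)) →
        (B : Subset nE) →
        (∀ {e f g} → e ∈ edges H → edge e ≺ face f → edge e ≺ face g → Enclosed f → ¬ Enclosed g → e ∈ B) →
        InteractsWithAtMost ∣ B ∣ H f₀ γ
      enclosed-atMost cyc greedy enclosed? =
        atMost cyc greedy same-face? enclosed? enclosed-closed f₀-not-enclosed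

-- Finite double-negation shift and the two bounds

¬¬-∀ : ∀ {n} {P : Fin n → Set} → (∀ i → ¬ ¬ P i) → ¬ ¬ (∀ i → P i)
¬¬-∀ = sequence (RawMonad.rawApplicative ¬¬-Monad)

¬¬-decide : ∀ {n} (P : Fin n → Set) → ¬ ¬ (∀ i → Dec (P i))
¬¬-decide P = ¬¬-∀ λ i → ¬¬-excluded-middle

lemma4p6 : (G : Graph) (S : SphereEmbedding G) → let open PlaneNotions G S in
    TwoConnected whole →
    (δ : ℚ) → 1ℚ ℚ.≤ δ →
    (k : ℕ) (C : List Dart) (f₀ : Fin nF) → IsFaceCycle whole C f₀ →
    (G′ : Part) → TwoConnected G′ → IsFaceCycle G′ C f₀ →
    (H : Part) → GreedyFilling ((+ 10 ℚ./ 1) ℚ.* δ) G′ C H → IsFilling k C f₀ H →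
    (γ : List Dart) → Cycle whole γ →
    InteractsWithAtMost ((k + 1) * length γ) H f₀ γ
    × (trace γ ⊆ᵖ H → InteractsWithAtMost (length γ) H f₀ γ)
lemma4p6 G S _ δ _ k C f₀ fc G′ _ (cyc , _) H greedy ((sub , _) , (cycH , _) , sizes) γ _ =
    (λ m F inj F-inter → decidably (m ≤? (k + 1) * length γ) λ same-face? enclosed? →
      let open Enclosure sub C⊆H same-face? γ in ℕ.≤-trans
        (enclosed-atMost cyc greedy enclosed? edges-near-γ boundary-near-γ m F inj F-inter)
        (∣edges-near-γ∣≤ sizes))
  , (λ γ⊆H m F inj F-inter → decidably (m ≤? length γ) λ same-face? enclosed? →
      let open Enclosure sub C⊆H same-face? γ in ℕ.≤-trans
        (enclosed-atMost cyc greedy enclosed? (edges (trace γ)) (λ _ → boundary-on-γ γ⊆H) m F inj F-inter)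
        (∣traceᵉ∣≤ γ))
  where
  open PlaneNotions G S
  open Walks G
  open Cells G S
  open Interactions G S
  open FaceCycle fc

  C⊆H : trace C ⊆ᶜ H
  C⊆H {c} = cellwise (CycleLemmas.cycle⊆ cycH) {c}

  -- Deciding Joined takes a search of the finite graph, which is avoided since the goal is decidable.
  decidably : ∀ {X : Set} → Dec X → ((∀ f g → Dec (SameFace H f g)) →
              (∀ f → Dec (FillingFace H f₀ f × Interacts H f₀ γ f)) → X) → X
  decidably X? prove = decidable-stable X? λ ¬X →
    ¬¬-∀ (λ f → ¬¬-decide (SameFace H f)) λ same-face? → ¬¬-decide _ (¬X ∘ prove same-face?)
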